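{- Let $\lambda>0$ be rational and suppose that, for every positive integer $n$, the maximizing $n$-term denominator tuple for $R_n^{\leq}(\lambda)$ is unique. Let $(b_n)_{n\geq 1}$ be the eventually greedy best sequence for $\lambda$ described in the context, and let $(a_n)_{n\geq 1}$ be a sequence of integers satisfying \[ 2\leq a_1\leq a_2\leq a_3\leq\cdots,\qquad \sum_{n=1}^{\infty}\frac1{a_n}=\lambda . \] If $(a_n)_{n\geq 1}\neq(b_n)_{n\geq 1}$, then \[ \liminf_{n\to\infty}a_n^{2^{ -n}}<\lim_{n\to\infty}b_n^{2^{ -n}} . \]
   Context: $\mathbb{N}=\{1,2,\ldots\}$. For $n\geq 1$ let $\mathcal{E}_n^{\leq}=\{(a_1,\ldots,a_n)\in\mathbb{N}^n: 2\leq a_1\leq\cdots\leq a_n\}$, and for real $\lambda>0$ let \[ R_n^{\leq}(\lambda)=\max\Bigl\{\sum_{i=1}^n\frac1{a_i}:\ (a_1,\ldots,a_n)\in\mathcal{E}_n^{\leq},\ \sum_{i=1}^n\frac1{a_i}<\lambda\Bigr\} \] (the maximum is known to exist). A tuple in $\mathcal{E}_n^{\leq}$ attaining this maximum is called a maximizing $n$-term denominator tuple. The sequence $(b_n)$: for every positive rational $\lambda$ the paper constructs an integer $N\geq 1$, a maximizing tuple $(b_1,\ldots,b_N)$ for $R_N^{\leq}(\lambda)$, and an integer $T_0\geq 2$ such that $\lambda=\sum_{i=1}^N 1/b_i+1/T_0$ and such that the following holds. Define $T_{j+1}=T_j(T_j+1)$ for $j\geq 0$ and extend $b_1,\ldots,b_N$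 to an infinite sequence by $b_{N+j+1}=T_j+1$ for $j\geq 0$; then $\sum_{n=1}^\infty 1/b_n=\lambda$ and $\sum_{i=1}^n 1/b_i=R_n^{\leq}(\lambda)$ for every $n\geq N$. The sequence $(b_n)_{n\geq 1}$ so obtained is the eventually greedy best sequence for $\lambda$. The limit $\lim_{n\to\infty}b_n^{2^{ -n}}$ exists and is finite and strictly positive. -}

module Defs where

open import Data.Nat.Base as ℕ using (ℕ; zero; suc)
import Data.Nat.Properties as ℕ
open import Data.Fin.Base using (toℕ)
open import Data.Integer.Base using (+_)
open import Data.Vec.Base using (Vec; []; _∷_; tabulate)
open import Data.Vec.Relation.Unary.Linked using (Linked)
open import Data.Rational.Base
open import Data.Rational.Properties
open import Data.Product.Base using (∃; _×_; _,_)
open import Data.Sum.Base using (_⊎_; inj₁; inj₂)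
open import Function.Bundles using (_⇔_; mk⇔; module Equivalence)
open import Relation.Binary.PropositionalEquality
open import Relation.Nullary using (yes; no; contradiction)
open import Algebra.Bundles using (CommutativeRing; CommutativeSemiring)

------------------------------------------------------------------------
-- Egyptian fractions

-- 1/n, with the junk value 0 at n = 0.
recip : ℕ → ℚ
recip zero    = 0ℚ
recip (suc n) = + 1 / suc n

Σrecip : ∀ {n} → Vec ℕ n → ℚ
Σrecip []       = 0ℚ
Σrecip (a ∷ as) = recip a + Σrecip as

-- 2 ≤ a₁ ≤ ⋯ ≤ aₙ
𝓔 : ∀ {n} → Vec ℕ n → Set
𝓔 as = Linked ℕ._≤_ (2 ∷ as)

Underapproximation : ℚ → ℕ → ℚ → Set
Underapproximation lam n r = ∃ λ (as : Vec ℕ n) → 𝓔 as × Σrecip as ≡ r × r < lam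

-- IsR lam n r means r = Rₙ≤(lam).
IsR : ℚ → ℕ → ℚ → Set
IsR lam n r = Underapproximation lam n r × (∀ s → Underapproximation lam n s → s ≤ r)

IsMaximizing : ℚ → ∀ {n} → Vec ℕ n → Set
IsMaximizing lam {n} as = 𝓔 as × IsR lam n (Σrecip as)

-- Sequences (a₁, a₂, …) are 0-based functions: a i stands for aᵢ₊₁.

prefix : (ℕ → ℕ) → ∀ n → Vec ℕ n
prefix a n = tabulate {n = n} (λ i → a (toℕ i))

SeriesSumsTo : (ℕ → ℕ) → ℚ → Set
SeriesSumsTo a s =
  ∀ ε → 0ℚ < ε → ∃ λ N → ∀ n → N ℕ.≤ n → ∣ Σrecip (prefix a n) - s ∣ < ε

T : ℕ → ℕ → ℕ
T T₀ zero    = T₀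
T T₀ (suc j) = T T₀ j ℕ.* suc (T T₀ j)

record EventuallyGreedyBest (lam : ℚ) (b : ℕ → ℕ) : Set where
  field
    N          : ℕ
    1≤N        : 1 ℕ.≤ N
    T₀         : ℕ
    2≤T₀       : 2 ℕ.≤ T₀
    maximizing : IsMaximizing lam (prefix b N)
    remainder  : lam ≡ Σrecip (prefix b N) + recip T₀
    greedy     : ∀ j → b (N ℕ.+ j) ≡ suc (T T₀ j)
    sums       : SeriesSumsTo b lam
    best       : ∀ n → N ℕ.≤ n → IsR lam n (Σrecip (prefix b n))

------------------------------------------------------------------------
-- Extended reals and reals as two-sided cuts of ℚ

-- Neither locatedness nor inhabitedness is required here, so that suprema and
-- infima of arbitrary sequences exist constructively; ±∞ are included.
-- L p reads p < x, and U q reads x < q.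
record Cut : Set₁ where
  field
    L U       : ℚ → Set
    L-rounded : ∀ p → L p ⇔ ∃ λ q → p < q × L q
    U-rounded : ∀ q → U q ⇔ ∃ λ p → p < q × U p
    L<U       : ∀ {p q} → L p → U q → p < q

open Cut

-- Dedekind reals
record ℝ : Set₁ where
  field
    cut         : Cut
    L-inhabited : ∃ (L cut)
    U-inhabited : ∃ (U cut)
    located     : ∀ {p q} → p < q → L cut p ⊎ U cut q

open ℝ public using (cut)

infix 4 _<ᶜ_ _⟶_

_<ᶜ_ : Cut → Cut → Set
x <ᶜ y = ∃ λ q → U x q × L y q

-- In inf, a common lower bound of all the x n need not be strictly below the
-- infimum, hence the extra room between p and q; dually for sup.
inf : (ℕ → Cut) → Cut
inf x = record
  { L         = λ p → ∃ λ q → p < q × (∀ n → L (x n) q)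
  ; U         = λ q → ∃ λ n → U (x n) q
  ; L-rounded = λ p → mk⇔
      (λ (q , p<q , Lq) → let m , p<m , m<q = <-dense p<q in m , p<m , q , m<q , Lq)
      (λ (m , p<m , q , m<q , Lq) → q , <-trans p<m m<q , Lq)
  ; U-rounded = λ q → mk⇔
      (λ (n , Uq) → let p , p<q , Up = to (U-rounded (x n) q) Uq in p , p<q , n , Up)
      (λ (p , p<q , n , Up) → n , from (U-rounded (x n) q) (p , p<q , Up))
  ; L<U       = λ (q , p<q , Lq) (n , Un) → <-trans p<q (L<U (x n) (Lq n) Un)
  }
  where open Equivalence

sup : (ℕ → Cut) → Cut
sup x = record
  { L         = λ p → ∃ λ n → L (x n) p
  ; U         = λ q → ∃ λ p → p < q × (∀ n → U (x n) p)
  ; L-rounded = λ p → mk⇔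
      (λ (n , Lp) → let q , p<q , Lq = to (L-rounded (x n) p) Lp in q , p<q , n , Lq)
      (λ (q , p<q , n , Lq) → n , from (L-rounded (x n) p) (q , p<q , Lq))
  ; U-rounded = λ q → mk⇔
      (λ (p , p<q , Up) → let m , p<m , m<q = <-dense p<q in m , m<q , p , p<m , Up)
      (λ (m , m<q , p , p<m , Up) → p , <-trans p<m m<q , Up)
  ; L<U       = λ (n , Ln) (q , q<r , Uq) → <-trans (L<U (x n) Ln (Uq n)) q<r
  }
  where open Equivalence

liminf : (ℕ → ℝ) → Cut
liminf x = sup λ N → inf λ n → cut (x (N ℕ.+ n))

-- Convergence in the order topology: every open rational interval around ℓ
-- eventually contains x n.
_⟶_ : (ℕ → ℝ) → ℝ → Set
x ⟶ ℓ =
  (∀ p → L (cut ℓ) p → ∃ λ N → ∀ n → N ℕ.≤ n → L (cut (x n)) p) ×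
  (∀ q → U (cut ℓ) q → ∃ λ N → ∀ n → N ℕ.≤ n → U (cut (x n)) q)

------------------------------------------------------------------------
-- The real numbers a^(2⁻ⁿ)

fromℕ : ℕ → ℚ
fromℕ a = + a / 1

-- p ^2^ n = p^(2ⁿ), by repeated squaring.
infix 8 _^2^_
_^2^_ : ℚ → ℕ → ℚ
p ^2^ zero  = p
p ^2^ suc n = (p * p) ^2^ n

module SemiringIdentities {c ℓ} (S : CommutativeSemiring c ℓ) where
  private module S = CommutativeSemiring S
  open S using (_≈_; 1#) renaming (_+_ to _⊕_; _*_ to _⊗_)
  open import Algebra.Solver.Ring.NaturalCoefficients.Default S

  id₁ : ∀ c x i → ((c ⊕ 1#) ⊗ x ⊕ c) ⊗ i ⊕ x ⊗ x ⊗ i ≈ x ⊗ ((x ⊕ (c ⊕ 1#)) ⊗ i) ⊕ c ⊗ i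
  id₁ = solve 3 (λ c x i →
    ((c :+ con 1) :* x :+ c) :* i :+ x :* x :* i
      := x :* ((x :+ (c :+ con 1)) :* i) :+ c :* i) S.refl

  id₂ : ∀ c x i →
    ((c ⊕ 1#) ⊗ x ⊕ c) ⊗ i ⊗ (((c ⊕ 1#) ⊗ x ⊕ c) ⊗ i) ⊕ c ⊗ ((c ⊗ c ⊕ c ⊕ 1#) ⊗ (i ⊗ i))
      ≈ c ⊗ ((x ⊕ (c ⊕ 1#)) ⊗ i ⊗ ((x ⊕ (c ⊕ 1#)) ⊗ i)) ⊕ x ⊗ x ⊗ ((c ⊗ c ⊕ c ⊕ 1#) ⊗ (i ⊗ i))
  id₂ = solve 3 (λ c x i →
    ((c :+ con 1) :* x :+ c) :* i :* (((c :+ con 1) :* x :+ c) :* i)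
        :+ c :* ((c :* c :+ c :+ con 1) :* (i :* i))
      := c :* ((x :+ (c :+ con 1)) :* i :* ((x :+ (c :+ con 1)) :* i))
        :+ x :* x :* ((c :* c :+ c :+ con 1) :* (i :* i))) S.refl

  y-eq : ∀ c x i → (x ⊕ (c ⊕ 1#)) ⊗ i ≈ 1# →
         ((c ⊕ 1#) ⊗ x ⊕ c) ⊗ i ⊕ x ⊗ x ⊗ i ≈ x ⊕ c ⊗ i
  y-eq c x i Di≈1 = S.trans (id₁ c x i)
    (S.+-congʳ (S.trans (S.*-congˡ Di≈1) (S.*-identityʳ x)))

  yy-eq : ∀ c x i → (x ⊕ (c ⊕ 1#)) ⊗ i ≈ 1# →
    ((c ⊕ 1#) ⊗ x ⊕ c) ⊗ i ⊗ (((c ⊕ 1#) ⊗ x ⊕ c) ⊗ i) ⊕ c ⊗ ((c ⊗ c ⊕ c ⊕ 1#) ⊗ (i ⊗ i))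
      ≈ c ⊕ x ⊗ x ⊗ ((c ⊗ c ⊕ c ⊕ 1#) ⊗ (i ⊗ i))
  yy-eq c x i Di≈1 = S.trans (id₂ c x i) (S.+-congʳ
    (S.trans (S.*-congˡ (S.trans (S.*-cong Di≈1 Di≈1) (S.*-identityˡ 1#))) (S.*-identityʳ c)))

module Identities =
  SemiringIdentities (CommutativeRing.commutativeSemiring +-*-commutativeRing)

module Powers where

  +-exchange-< : ∀ a b {u v} → a + u ≡ b + v → u < v → b < a
  +-exchange-< a b eq u<v with b <? a
  ... | yes b<a = b<a
  ... | no  b≮a = contradiction (+-mono-≤-< (≮⇒≥ b≮a) u<v) (<-irrefl eq)

  mul-pos : ∀ {p q} → 0ℚ < p → 0ℚ < q → 0ℚ < p * q
  mul-pos {p} {q} 0<p 0<q =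
    positive⁻¹ (p * q) {{pos*pos⇒pos p {{positive 0<p}} q {{positive 0<q}}}}

  sq-nonneg : ∀ {p} → 0ℚ ≤ p → 0ℚ ≤ p * p
  sq-nonneg {p} 0≤p =
    nonNegative⁻¹ (p * p)
      {{nonNeg*nonNeg⇒nonNeg p {{nonNegative 0≤p}} p {{nonNegative 0≤p}}}}

  sq-mono : ∀ {p q} → 0ℚ ≤ p → p < q → p * p < q * q
  sq-mono {p} {q} 0≤p p<q =
    ≤-<-trans (*-monoˡ-≤-nonNeg p {{nonNegative 0≤p}} (<⇒≤ p<q))
              (*-monoˡ-<-pos q {{positive (≤-<-trans 0≤p p<q)}} p<q)

  -- One step x ↦ (Kx + c)/(x + K), K = c + 1, towards √c from either side.
  module Step (c x : ℚ) (0<c : 0ℚ < c) (0≤x : 0ℚ ≤ x) where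
    K D : ℚ
    K = c + 1ℚ
    D = x + K

    0<K : 0ℚ < K
    0<K = +-mono-< 0<c (positive⁻¹ 1ℚ)

    0<D : 0ℚ < D
    0<D = +-mono-≤-< 0≤x 0<K

    instance
      D-pos : Positive D
      D-pos = positive 0<D

      D-nonZero : NonZero D
      D-nonZero = pos⇒nonZero D

    i : ℚ
    i = 1/ D

    0<i : 0ℚ < i
    0<i = positive⁻¹ i {{1/pos⇒pos D}}

    y : ℚ
    y = (K * x + c) * i

    0<y : 0ℚ < y
    0<y = mul-pos (+-mono-≤-< 0≤Kx 0<c) 0<i
      where
      0≤Kx : 0ℚ ≤ K * x
      0≤Kx = nonNegative⁻¹ (K * x)
        {{nonNeg*nonNeg⇒nonNeg K {{nonNegative (<⇒≤ 0<K)}} x {{nonNegative 0≤x}}}}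

    D*i≡1 : D * i ≡ 1ℚ
    D*i≡1 = *-inverseʳ D

    -- E = K² - c
    E e : ℚ
    E = c * c + c + 1ℚ
    e = E * (i * i)

    0<e : 0ℚ < e
    0<e = mul-pos (+-mono-< (+-mono-< (mul-pos 0<c 0<c) 0<c) (positive⁻¹ 1ℚ))
                  (mul-pos 0<i 0<i)

    y-eq : y + x * x * i ≡ x + c * i
    y-eq = Identities.y-eq c x i D*i≡1

    yy-eq : y * y + c * e ≡ c + x * x * e
    yy-eq = Identities.yy-eq c x i D*i≡1

  sq-up : ∀ {p c} → 0ℚ ≤ p → p * p < c → ∃ λ q → p < q × q * q < c
  sq-up {p} {c} 0≤p pp<c =
    y , +-exchange-< y p y-eq (*-monoˡ-<-pos i {{positive 0<i}} pp<c)
      , +-exchange-< c (y * y) (sym yy-eq) (*-monoˡ-<-pos e {{positive 0<e}} pp<c)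
    where open Step c p (≤-<-trans (sq-nonneg 0≤p) pp<c) 0≤p

  sq-down : ∀ {q c} → 0ℚ < q → 0ℚ < c → c < q * q →
            ∃ λ p → p < q × 0ℚ < p × c < p * p
  sq-down {q} {c} 0<q 0<c c<qq =
    y , +-exchange-< q y (sym y-eq) (*-monoˡ-<-pos i {{positive 0<i}} c<qq)
      , 0<y
      , +-exchange-< (y * y) c yy-eq (*-monoˡ-<-pos e {{positive 0<e}} c<qq)
    where open Step c q 0<c (<⇒≤ 0<q)

  pow-mono : ∀ n {p q} → 0ℚ ≤ p → p < q → p ^2^ n < q ^2^ n
  pow-mono zero    _   p<q = p<q
  pow-mono (suc n) 0≤p p<q = pow-mono n (sq-nonneg 0≤p) (sq-mono 0≤p p<q)

  pow-up : ∀ n {p c} → 0ℚ ≤ p → p ^2^ n < c → ∃ λ q → p < q × q ^2^ n < c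
  pow-up zero    _   p<c = <-dense p<c
  pow-up (suc n) 0≤p p<c =
    let r , pp<r , r<c = pow-up n (sq-nonneg 0≤p) p<c
        q , p<q , qq<r = sq-up 0≤p pp<r
        0≤q = ≤-trans 0≤p (<⇒≤ p<q)
    in q , p<q , <-trans (pow-mono n (sq-nonneg 0≤q) qq<r) r<c

  pow-down : ∀ n {q c} → 0ℚ < q → 0ℚ ≤ c → c < q ^2^ n →
             ∃ λ p → p < q × 0ℚ < p × c < p ^2^ n
  pow-down zero 0<q 0≤c c<q =
    let p , c<p , p<q = <-dense c<q
    in p , p<q , ≤-<-trans 0≤c c<p , c<p
  pow-down (suc n) 0<q 0≤c c<q =
    let r , r<qq , 0<r , c<r = pow-down n (mul-pos 0<q 0<q) 0≤c c<q
        p , p<q , 0<p , r<pp = sq-down 0<q 0<r r<qq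
    in p , p<q , 0<p , <-trans c<r (pow-mono n (<⇒≤ 0<r) r<pp)

  pow-large : ∀ n {q} → 1ℚ ≤ q → q ≤ q ^2^ n
  pow-large zero        _   = ≤-refl
  pow-large (suc n) {q} 1≤q = ≤-trans q≤qq (pow-large n (≤-trans 1≤q q≤qq))
    where
    q≤qq : q ≤ q * q
    q≤qq = subst (_≤ q * q) (*-identityʳ q)
      (*-monoˡ-≤-nonNeg q {{nonNegative (≤-trans (nonNegative⁻¹ 1ℚ) 1≤q)}} 1≤q)

  0≤fromℕ : ∀ a → 0ℚ ≤ fromℕ a
  0≤fromℕ a = nonNegative⁻¹ (fromℕ a) {{normalize-nonNeg a 1}}

open Powers

-- The nonnegative real a^(2⁻ⁿ).
root2^ : ℕ → ℕ → ℝ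
root2^ n a = record
  { cut = record
    { L         = Lo
    ; U         = Up
    ; L-rounded = λ p → mk⇔ (Lo-open p) (λ (q , p<q , Lq) → Lo-down p<q Lq)
    ; U-rounded = λ q → mk⇔ (Up-open q) (λ (p , p<q , Up) → Up-up p<q Up)
    ; L<U       = Lo<Up
    }
  ; L-inhabited = - 1ℚ , inj₁ (negative⁻¹ (- 1ℚ))
  ; U-inhabited = fromℕ a + 1ℚ , 0<a+1 , <-≤-trans a<a+1 (pow-large n 1≤a+1)
  ; located     = Lo-or-Up
  }
  where
  Lo Up : ℚ → Set
  Lo p = p < 0ℚ ⊎ p ^2^ n < fromℕ a
  Up q = 0ℚ < q × fromℕ a < q ^2^ n

  1≤a+1 : 1ℚ ≤ fromℕ a + 1ℚ
  1≤a+1 = +-monoˡ-≤ 1ℚ (0≤fromℕ a)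

  0<a+1 : 0ℚ < fromℕ a + 1ℚ
  0<a+1 = <-≤-trans (positive⁻¹ 1ℚ) 1≤a+1

  a<a+1 : fromℕ a < fromℕ a + 1ℚ
  a<a+1 = subst (_< fromℕ a + 1ℚ) (+-identityʳ (fromℕ a))
    (+-monoʳ-< (fromℕ a) (positive⁻¹ 1ℚ))

  Lo-open : ∀ p → Lo p → ∃ λ q → p < q × Lo q
  Lo-open p (inj₁ p<0) with <-dense p<0
  ... | q , p<q , q<0 = q , p<q , inj₁ q<0
  Lo-open p (inj₂ pᵏ<a) with p <? 0ℚ
  ... | yes p<0 = Lo-open p (inj₁ p<0)
  ... | no  p≮0 with pow-up n (≮⇒≥ p≮0) pᵏ<a
  ...   | q , p<q , qᵏ<a = q , p<q , inj₂ qᵏ<a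

  Lo-down : ∀ {p q} → p < q → Lo q → Lo p
  Lo-down         p<q (inj₁ q<0)  = inj₁ (<-trans p<q q<0)
  Lo-down {p} {q} p<q (inj₂ qᵏ<a) with p <? 0ℚ
  ... | yes p<0 = inj₁ p<0
  ... | no  p≮0 = inj₂ (<-trans (pow-mono n (≮⇒≥ p≮0) p<q) qᵏ<a)

  Up-open : ∀ q → Up q → ∃ λ p → p < q × Up p
  Up-open q (0<q , a<qᵏ) = pow-down n 0<q (0≤fromℕ a) a<qᵏ

  Up-up : ∀ {p q} → p < q → Up p → Up q
  Up-up p<q (0<p , a<pᵏ) =
    <-trans 0<p p<q , <-trans a<pᵏ (pow-mono n (<⇒≤ 0<p) p<q)

  Lo<Up : ∀ {p q} → Lo p → Up q → p < q
  Lo<Up         (inj₁ p<0)  (0<q , _)    = <-trans p<0 0<q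
  Lo<Up {p} {q} (inj₂ pᵏ<a) (0<q , a<qᵏ) with p <? q
  ... | yes p<q = p<q
  ... | no  p≮q with q <? p
  ...   | yes q<p = contradiction
                      (<-trans (<-trans a<qᵏ (pow-mono n (<⇒≤ 0<q) q<p)) pᵏ<a)
                      (<-irrefl refl)
  ...   | no  q≮p with ≤-antisym (≮⇒≥ q≮p) (≮⇒≥ p≮q)
  ...     | refl = contradiction (<-trans a<qᵏ pᵏ<a) (<-irrefl refl)

  Lo-or-Up : ∀ {p q} → p < q → Lo p ⊎ Up q
  Lo-or-Up {p} {q} p<q with p <? 0ℚ
  ... | yes p<0 = inj₁ (inj₁ p<0)
  ... | no  p≮0 with p ^2^ n <? fromℕ a
  ...   | yes pᵏ<a = inj₁ (inj₂ pᵏ<a)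
  ...   | no  pᵏ≮a = inj₂ ( ≤-<-trans (≮⇒≥ p≮0) p<q
                          , ≤-<-trans (≮⇒≥ pᵏ≮a) (pow-mono n (≮⇒≥ p≮0) p<q))

-- The sequence aₙ^(2⁻ⁿ), n ≥ 1, again indexed from 0.
roots : (ℕ → ℕ) → ℕ → ℝ
roots a i = root2^ (suc i) (a i)

{-# OPTIONS --safe #-}

-- Let δₙ = λ − (1/a₁ + ⋯ + 1/aₙ) and let Tₙ be the value with λ − Rₙ(λ) = 1/Tₙ. By uniqueness
-- 1/δₙ < Tₙ as soon as a and b have parted. The fraction δₙ = pₙ/Qₙ, with Qₙ = den(λ) a₁⋯aₙ, has
-- numerator pₙ ≥ 1. A lower bound π for the numerators bounds δ from below by the remainders of
-- the real greedy sequence that realises π with equality: if δ fell below, then the monotonicity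
-- of a and summation by parts would bound the mean of aᵢ/gᵢ by 1, where the gᵢ are the greedy
-- denominators, whereas their product exceeds 1, against the AM–GM inequality. By well-founded
-- induction on pₙ there is an n after which 1/δ stays below a greedy sequence started strictly below T: while p does not drop
-- below pₙ, 1/δ falls behind T by an arbitrary factor, which outweighs a later drop of p to 1.
-- Finally, δ → 0 forces infinitely many aₖ to be at most the corresponding greedy denominators.
-- Every step is effective, as the cut inequality demands.

module Submission where

open import Defs
open import Data.Nat.Base as ℕ using (ℕ; zero; suc)
import Data.Nat.Properties as ℕ
open import Data.Nat.Induction using (<-wellFounded)
open import Data.Integer.Base as ℤ using (ℤ)
import Data.Integer.Properties as ℤ
open import Data.Rational.Base
open import Data.Rational.Properties
open import Data.Rational.Solver using (module +-*-Solver)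
import Data.Rational.Unnormalised.Base as ℚᵘ
import Data.Rational.Unnormalised.Properties as ℚᵘ
open import Data.Vec.Base using (Vec; []; _∷_)
import Data.Vec.Properties as Vec
open import Data.Vec.Relation.Unary.Linked using (Linked; [-]; _∷_)
open import Data.Product using (∃; ∃₂; ∃!; _×_; _,_; proj₁; proj₂)
open import Data.Sum using (inj₁; inj₂)
open import Function.Base using (_∘_)
open import Induction.WellFounded using (Acc; acc)
open import Relation.Nullary using (¬_; Dec; yes; no; contradiction)
open import Relation.Binary.Definitions using (tri<; tri≈; tri>)
open import Relation.Binary.PropositionalEquality
open +-*-Solver using (solve; _:=_; con; _:+_; _:*_; _:-_; :-_)
open Powers

-- Order arithmetic in the rationals

0≤p-q : ∀ {p q} → q ≤ p → 0ℚ ≤ p - q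
0≤p-q {p} {q} q≤p = subst (_≤ p - q) (+-inverseʳ q) (+-monoˡ-≤ (- q) q≤p)

0<p-q : ∀ {p q} → q < p → 0ℚ < p - q
0<p-q {p} {q} q<p = subst (_< p - q) (+-inverseʳ q) (+-monoˡ-< (- q) q<p)

≤-by : ∀ {p q} e → 0ℚ ≤ e → p + e ≡ q → p ≤ q
≤-by {p} e 0≤e eq = subst₂ _≤_ (+-identityʳ p) eq (+-monoʳ-≤ p 0≤e)

<-by : ∀ {p q} e → 0ℚ < e → p + e ≡ q → p < q
<-by {p} e 0<e eq = subst₂ _<_ (+-identityʳ p) eq (+-monoʳ-< p 0<e)

add-nonneg : ∀ {p q} → 0ℚ ≤ p → 0ℚ ≤ q → 0ℚ ≤ p + q
add-nonneg = +-mono-≤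

mul-nonneg : ∀ {p q} → 0ℚ ≤ p → 0ℚ ≤ q → 0ℚ ≤ p * q
mul-nonneg {p} {q} 0≤p 0≤q = nonNegative⁻¹ (p * q)
  {{nonNeg*nonNeg⇒nonNeg p {{nonNegative 0≤p}} q {{nonNegative 0≤q}}}}

0<1 : 0ℚ < 1ℚ
0<1 = positive⁻¹ 1ℚ

0≤1 : 0ℚ ≤ 1ℚ
0≤1 = <⇒≤ 0<1

reciprocal : ∀ {p} → 0ℚ < p → ∃ λ q → 0ℚ < q × p * q ≡ 1ℚ
reciprocal {p} 0<p = (1/ p) , positive⁻¹ (1/ p) {{1/pos⇒pos p}} , *-inverseʳ p
  where instance
    p-pos : Positive p
    p-pos = positive 0<p
    p-nonZero : NonZero p
    p-nonZero = pos⇒nonZero p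

*-cancelˡ-≡-pos : ∀ {r p q} → 0ℚ < r → r * p ≡ r * q → p ≡ q
*-cancelˡ-≡-pos {r} 0<r eq = ≤-antisym
  (*-cancelˡ-≤-pos r {{positive 0<r}} (≤-reflexive eq))
  (*-cancelˡ-≤-pos r {{positive 0<r}} (≤-reflexive (sym eq)))

-- The embedding of the integers

fromℤ : ℤ → ℚ
fromℤ i = i / 1

toℚᵘ-fromℤ : ∀ i → toℚᵘ (fromℤ i) ℚᵘ.≃ ℚᵘ.mkℚᵘ i 0
toℚᵘ-fromℤ i = toℚᵘ-fromℚᵘ (ℚᵘ.mkℚᵘ i 0)

fromℤ-+ : ∀ i j → fromℤ (i ℤ.+ j) ≡ fromℤ i + fromℤ j
fromℤ-+ i j = toℚᵘ-injective (ℚᵘ.≃-trans (toℚᵘ-fromℤ (i ℤ.+ j)) (ℚᵘ.≃-sym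
  (ℚᵘ.≃-trans (toℚᵘ-homo-+ (fromℤ i) (fromℤ j))
  (ℚᵘ.≃-trans (ℚᵘ.+-cong (toℚᵘ-fromℤ i) (toℚᵘ-fromℤ j))
    (ℚᵘ.*≡* (cong (ℤ._* (ℤ.+ 1)) (cong₂ ℤ._+_ (ℤ.*-identityʳ i) (ℤ.*-identityʳ j))))))))

fromℤ-* : ∀ i j → fromℤ (i ℤ.* j) ≡ fromℤ i * fromℤ j
fromℤ-* i j = toℚᵘ-injective (ℚᵘ.≃-trans (toℚᵘ-fromℤ (i ℤ.* j)) (ℚᵘ.≃-sym
  (ℚᵘ.≃-trans (toℚᵘ-homo-* (fromℤ i) (fromℤ j))
    (ℚᵘ.*-cong (toℚᵘ-fromℤ i) (toℚᵘ-fromℤ j)))))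

fromℤ-neg : ∀ i → fromℤ (ℤ.- i) ≡ - fromℤ i
fromℤ-neg i = toℚᵘ-injective (ℚᵘ.≃-trans (toℚᵘ-fromℤ (ℤ.- i)) (ℚᵘ.≃-sym
  (ℚᵘ.≃-trans (toℚᵘ-homo‿- (fromℤ i)) (ℚᵘ.-‿cong (toℚᵘ-fromℤ i)))))

fromℕ-+ : ∀ m n → fromℕ (m ℕ.+ n) ≡ fromℕ m + fromℕ n
fromℕ-+ m n = fromℤ-+ (ℤ.+ m) (ℤ.+ n)

fromℕ-* : ∀ m n → fromℕ (m ℕ.* n) ≡ fromℕ m * fromℕ n
fromℕ-* m n = trans (cong fromℤ (ℤ.pos-* m n)) (fromℤ-* (ℤ.+ m) (ℤ.+ n))

fromℕ-suc : ∀ n → fromℕ (suc n) ≡ fromℕ n + 1ℚ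
fromℕ-suc n = trans (fromℕ-+ 1 n) (+-comm 1ℚ (fromℕ n))

fromℕ-mono-≤ : ∀ {m n} → m ℕ.≤ n → fromℕ m ≤ fromℕ n
fromℕ-mono-≤ {m} {n} m≤n = ≤-by (fromℕ (n ℕ.∸ m)) (0≤fromℕ (n ℕ.∸ m))
  (trans (sym (fromℕ-+ m (n ℕ.∸ m))) (cong fromℕ (ℕ.m+[n∸m]≡n m≤n)))

fromℕ-mono-< : ∀ {m n} → m ℕ.< n → fromℕ m < fromℕ n
fromℕ-mono-< {m} m<n = <-≤-trans (<-by 1ℚ 0<1 (sym (fromℕ-suc m))) (fromℕ-mono-≤ m<n)

recip-pos : ∀ {a} → 1 ℕ.≤ a → 0ℚ < recip a
recip-pos {suc a} _ = positive⁻¹ (ℤ.+ 1 / suc a) {{normalize-pos 1 (suc a)}}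

fromℕ*recip : ∀ {a} → 1 ℕ.≤ a → fromℕ a * recip a ≡ 1ℚ
fromℕ*recip {suc a} _ = toℚᵘ-injective (ℚᵘ.≃-trans
  (toℚᵘ-homo-* (fromℕ (suc a)) (ℤ.+ 1 / suc a))
  (ℚᵘ.≃-trans (ℚᵘ.*-cong (toℚᵘ-fromℤ (ℤ.+ suc a)) (toℚᵘ-fromℚᵘ (ℚᵘ.mkℚᵘ (ℤ.+ 1) a)))
    (ℚᵘ.*≡* (trans (ℤ.*-identityʳ (ℤ.+ suc a ℤ.* ℤ.+ 1)) (trans (ℤ.*-identityʳ (ℤ.+ suc a))
      (sym (trans (ℤ.*-identityˡ _) (cong ℤ.+_ (ℕ.*-identityˡ (suc a))))))))))

denominator-integral : ∀ p → p * fromℕ (↧ₙ p) ≡ fromℤ (↥ p)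
denominator-integral p = toℚᵘ-injective (ℚᵘ.≃-trans
  (toℚᵘ-homo-* p (fromℕ (↧ₙ p)))
  (ℚᵘ.≃-trans (ℚᵘ.*-congˡ {toℚᵘ p} (toℚᵘ-fromℤ (ℤ.+ ↧ₙ p))) (ℚᵘ.≃-trans (lemma p)
    (ℚᵘ.≃-sym (toℚᵘ-fromℤ (↥ p))))))
  where
  lemma : ∀ p → toℚᵘ p ℚᵘ.* ℚᵘ.mkℚᵘ (↧ p) 0 ℚᵘ.≃ ℚᵘ.mkℚᵘ (↥ p) 0
  -- The match on the record is what lets `toℚᵘ p` compute.
  lemma p@record{} = ℚᵘ.*≡* (trans (ℤ.*-identityʳ (↥ p ℤ.* ↧ p))
    (cong (↥ p ℤ.*_) (cong ℤ.+_ (sym (ℕ.*-identityʳ (↧ₙ p))))))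

-- The absolute value of the numerator serves, because the denominator is at least 1.
archimedean : ∀ p → ∃ λ n → p ≤ fromℕ n
archimedean p = ℤ.∣ ↥ p ∣ , (*-cancelʳ-≤-pos d {{positive 0<d}} (begin
  p * d                     ≡⟨ denominator-integral p ⟩
  fromℤ (↥ p)               ≤⟨ i≤∣i∣ (↥ p) ⟩
  n                         ≡⟨ *-identityʳ n ⟨
  n * 1ℚ                    ≤⟨ *-monoˡ-≤-nonNeg n {{nonNegative (0≤fromℕ ℤ.∣ ↥ p ∣)}} (fromℕ-mono-≤ {1} 1≤d) ⟩
  n * d                     ∎))
  where
  open ≤-Reasoning
  n d : ℚ
  n = fromℕ ℤ.∣ ↥ p ∣
  d = fromℕ (↧ₙ p)
  1≤d : 1 ℕ.≤ ↧ₙ p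
  1≤d = ℕ.s≤s ℕ.z≤n
  0<d : 0ℚ < d
  0<d = fromℕ-mono-< {0} 1≤d
  i≤∣i∣ : ∀ i → fromℤ i ≤ fromℕ ℤ.∣ i ∣
  i≤∣i∣ (ℤ.+ m)      = ≤-refl
  i≤∣i∣ (ℤ.-[1+ m ]) = ≤-trans (<⇒≤ (negative⁻¹ (fromℤ ℤ.-[1+ m ]) {{ -m<0 }})) (0≤fromℕ (suc m))
    where
    -m<0 : Negative (fromℤ ℤ.-[1+ m ])
    -m<0 = neg-pos {fromℕ (suc m)} (normalize-pos (suc m) 1)

-- Finite sums and products, Bernoulli's inequality and AM-GM

∑ ∏ : (ℕ → ℚ) → ℕ → ℚ
∑ x zero    = 0ℚ
∑ x (suc n) = ∑ x n + x n
∏ x zero    = 1ℚ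
∏ x (suc n) = ∏ x n * x n

infixr 8 _^ℚ_
_^ℚ_ : ℚ → ℕ → ℚ
p ^ℚ n = ∏ (λ _ → p) n

∑-nonneg : ∀ {x} → (∀ i → 0ℚ ≤ x i) → ∀ n → 0ℚ ≤ ∑ x n
∑-nonneg 0≤x zero    = ≤-refl
∑-nonneg 0≤x (suc n) = add-nonneg (∑-nonneg 0≤x n) (0≤x n)

∏-nonneg : ∀ {x} → (∀ i → 0ℚ ≤ x i) → ∀ n → 0ℚ ≤ ∏ x n
∏-nonneg 0≤x zero    = 0≤1
∏-nonneg 0≤x (suc n) = mul-nonneg (∏-nonneg 0≤x n) (0≤x n)

1^ℚ : ∀ n → 1ℚ ^ℚ n ≡ 1ℚ
1^ℚ zero    = refl
1^ℚ (suc n) = trans (*-identityʳ (1ℚ ^ℚ n)) (1^ℚ n)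

-- This is AM-GM for n copies of c + d and one term c - n d, whose mean is c. The step rests on (c +
-- d)(c - (n + 1) d) = (c - n d) c - (n + 1) d².
bernoulli : ∀ n {c d} → 0ℚ ≤ c → 0ℚ ≤ c + d →
            (c + d) ^ℚ n * (c - fromℕ n * d) ≤ c ^ℚ suc n
bernoulli zero {c} {d} _ _ = ≤-reflexive
  (solve 2 (λ c d → con 1ℚ :* (c :- con 0ℚ :* d) := con 1ℚ :* c) refl c d)
bernoulli (suc n) {c} {d} 0≤c 0≤c+d = begin
  u * (c + d) * (c - fromℕ (suc n) * d)
    ≡⟨ cong (λ m → u * (c + d) * (c - m * d)) (fromℕ-suc n) ⟩
  u * (c + d) * (c - (k + 1ℚ) * d)
    ≤⟨ ≤-by (u * ((k + 1ℚ) * (d * d)))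
         (mul-nonneg 0≤u (mul-nonneg (add-nonneg (0≤fromℕ n) 0≤1) (0≤p² d)))
         (solve 4 (λ u k c d →
           u :* (c :+ d) :* (c :- (k :+ con 1ℚ) :* d) :+ u :* ((k :+ con 1ℚ) :* (d :* d))
             := u :* (c :- k :* d) :* c) refl u k c d) ⟩
  u * (c - k * d) * c
    ≤⟨ *-monoʳ-≤-nonNeg c {{nonNegative 0≤c}} (bernoulli n 0≤c 0≤c+d) ⟩
  c ^ℚ suc n * c ∎
  where
  open ≤-Reasoning
  k u : ℚ
  k = fromℕ n
  u = (c + d) ^ℚ n
  0≤u : 0ℚ ≤ u
  0≤u = ∏-nonneg (λ _ → 0≤c+d) n
  0≤p² : ∀ p → 0ℚ ≤ p * p
  0≤p² p with ≤-total 0ℚ p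
  ... | inj₁ 0≤p = sq-nonneg 0≤p
  ... | inj₂ p≤0 = nonNegative⁻¹ (p * p)
    {{nonPos*nonPos⇒nonPos p {{nonPositive p≤0}} p {{nonPositive p≤0}}}}

-- The induction step replaces c by the mean of the first n terms.
am-gm : ∀ {x} → (∀ i → 0ℚ ≤ x i) → ∀ n {c} → 0ℚ ≤ c → ∑ x n ≤ fromℕ n * c → ∏ x n ≤ c ^ℚ n
am-gm 0≤x zero _ _ = ≤-refl
-- A single term is treated apart, since the step below divides by the number of preceding terms.
am-gm {x} 0≤x (suc zero) {c} _ s≤c = *-monoˡ-≤-nonNeg 1ℚ
  (subst₂ _≤_ (+-identityˡ (x 0)) (*-identityˡ c) s≤c)
am-gm {x} 0≤x (suc n@(suc _)) {c} 0≤c s≤ = begin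
  ∏ x n * x n
    ≤⟨ *-monoʳ-≤-nonNeg (x n) {{nonNegative (0≤x n)}}
         (am-gm 0≤x n 0≤mean (≤-reflexive s≡k*mean)) ⟩
  mean ^ℚ n * x n
    ≤⟨ *-monoˡ-≤-nonNeg (mean ^ℚ n) {{nonNegative (∏-nonneg (λ _ → 0≤mean) n)}} xₙ≤ ⟩
  mean ^ℚ n * (c - k * (mean - c))
    ≡⟨ cong (λ p → p ^ℚ n * (c - k * (mean - c))) mean≡ ⟩
  (c + (mean - c)) ^ℚ n * (c - k * (mean - c))
    ≤⟨ bernoulli n 0≤c (subst (0ℚ ≤_) mean≡ 0≤mean) ⟩
  c ^ℚ suc n ∎
  where
  open ≤-Reasoning
  k s mean : ℚ
  k = fromℕ n
  s = ∑ x n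
  mean = s * recip n
  k*r≡1 : k * recip n ≡ 1ℚ
  k*r≡1 = fromℕ*recip {n} (ℕ.s≤s ℕ.z≤n)
  0≤mean : 0ℚ ≤ mean
  0≤mean = mul-nonneg (∑-nonneg 0≤x n) (<⇒≤ (recip-pos {n} (ℕ.s≤s ℕ.z≤n)))
  mean≡ : mean ≡ c + (mean - c)
  mean≡ = solve 2 (λ m c → m := c :+ (m :- c)) refl mean c
  s≡k*mean : s ≡ k * mean
  s≡k*mean = trans (sym (*-identityʳ s)) (trans (cong (s *_) (sym k*r≡1))
    (solve 3 (λ s k r → s :* (k :* r) := k :* (s :* r)) refl s k (recip n)))
  -- What the bound (n + 1) c on the whole sum leaves for the last term.
  xₙ≤ : x n ≤ c - k * (mean - c)
  xₙ≤ = ≤-by (fromℕ (suc n) * c - (s + x n)) (0≤p-q s≤)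
    (trans (cong (λ m → x n + (m * c - (s + x n))) (fromℕ-suc n))
    (trans (solve 4 (λ y k c s → y :+ ((k :+ con 1ℚ) :* c :- (s :+ y)) := c :- (s :- k :* c)) refl (x n) k c s)
    (trans (cong (λ t → c - (t - k * c)) s≡k*mean)
      (solve 3 (λ k c m → c :- (k :* m :- k :* c) := c :- k :* (m :- c)) refl k c mean))))

-- Comparison of a sequence of unit fractions with a greedy one

-- growth ρ y k: the denominators y ↦ y (ρ y + 1), where 1/y − 1/(y + 1/ρ) = 1/(y (ρ y + 1)).
growth : (ℕ → ℚ) → ℚ → ℕ → ℚ
growth ρ y zero    = y
growth ρ y (suc k) = growth (λ i → ρ (suc i)) (y * (y * ρ 0 + 1ℚ)) k

-- `growth` recurses on its starting value, which makes restarting at a later term easy; this is the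
-- recursion at the far end.
growth-suc : ∀ ρ y k → growth ρ y (suc k) ≡ growth ρ y k * (growth ρ y k * ρ k + 1ℚ)
growth-suc ρ y zero    = refl
growth-suc ρ y (suc k) = growth-suc (λ i → ρ (suc i)) (y * (y * ρ 0 + 1ℚ)) k

growth-pos : ∀ {ρ y} → (∀ i → 0ℚ < ρ i) → 0ℚ < y → ∀ k → 0ℚ < growth ρ y k
growth-pos         0<ρ 0<y zero    = 0<y
growth-pos {ρ} {y} 0<ρ 0<y (suc k) = growth-pos (λ i → 0<ρ (suc i))
  (mul-pos 0<y (+-mono-< (mul-pos 0<y (0<ρ 0)) 0<1)) k

-- A are the denominators, δ the remainders and Q the common denominators, so that δ Q are the
-- numerators. These are bounded below by π, with equality at 0, and ρ i = π i / π (i + 1). The aim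
-- is `1≤δY`: δ n is at least the greedy remainder 1 / Y n.
module Comparison
  (A δ Q π ρ : ℕ → ℚ)
  (0≤A : ∀ i → 0ℚ ≤ A i) (A-mono : ∀ i → A i ≤ A (suc i))
  (A*Δδ : ∀ i → A i * (δ i - δ (suc i)) ≡ 1ℚ)
  (0<δ₀ : 0ℚ < δ 0)
  (Q-suc : ∀ i → Q (suc i) ≡ Q i * A i)
  (0≤Q : ∀ i → 0ℚ ≤ Q i)
  (0<π : ∀ i → 0ℚ < π i) (0<ρ : ∀ i → 0ℚ < ρ i)
  (π≡ : ∀ i → π i ≡ ρ i * π (suc i))
  (π₀≡ : δ 0 * Q 0 ≡ π 0) (π≤δQ : ∀ i → π i ≤ δ i * Q i)
  (y₀ : ℚ) (0<y₀ : 0ℚ < y₀) (δ₀y₀ : δ 0 * y₀ ≡ 1ℚ)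
  where

  -- `η` are the greedy remainders. The greedy denominator is g i = Y i + 1/ρ i = 1/(η i - η (i +
  -- 1)), so that x i = A i / g i.
  Y η x : ℕ → ℚ
  Y = growth ρ y₀

  0<Y : ∀ i → 0ℚ < Y i
  0<Y = growth-pos 0<ρ 0<y₀

  η i = proj₁ (reciprocal (0<Y i))
  x i = A i * (η i - η (suc i))

  0<η : ∀ i → 0ℚ < η i
  0<η i = proj₁ (proj₂ (reciprocal (0<Y i)))

  Yη : ∀ i → Y i * η i ≡ 1ℚ
  Yη i = proj₂ (proj₂ (reciprocal (0<Y i)))

  η₀≡δ₀ : η 0 ≡ δ 0
  η₀≡δ₀ = trans (sym (*-identityˡ (η 0))) (trans (cong (_* η 0) (sym δ₀y₀))
    (trans (*-assoc (δ 0) y₀ (η 0)) (trans (cong (δ 0 *_) (Yη 0)) (*-identityʳ (δ 0)))))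

  Δη : ∀ i → η i - η (suc i) ≡ ρ i * Y i * η (suc i)
  Δη i = begin
    e - f
      ≡⟨ cong₂ _-_ (sym (*-identityʳ e)) (sym (*-identityʳ f)) ⟩
    e * 1ℚ - f * 1ℚ
      ≡⟨ cong₂ (λ p q → e * p - f * q) (sym Y'η') (sym (Yη i)) ⟩
    e * (z * (z * r + 1ℚ) * f) - f * (z * e)
      ≡⟨ solve 4 (λ e f z r →
           e :* (z :* (z :* r :+ con 1ℚ) :* f) :- f :* (z :* e) := z :* e :* (r :* z :* f))
           refl e f z r ⟩
    z * e * (r * z * f)
      ≡⟨ trans (cong (_* (r * z * f)) (Yη i)) (*-identityˡ (r * z * f)) ⟩
    r * z * f ∎
    where
    open ≡-Reasoning
    e f z r : ℚ
    e = η i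
    f = η (suc i)
    z = Y i
    r = ρ i
    Y'η' : z * (z * r + 1ℚ) * f ≡ 1ℚ
    Y'η' = trans (cong (_* f) (sym (growth-suc ρ y₀ i))) (Yη (suc i))

  0≤x : ∀ i → 0ℚ ≤ x i
  0≤x i = mul-nonneg (0≤A i) (subst (0ℚ ≤_) (sym (Δη i))
    (<⇒≤ (mul-pos (mul-pos (0<ρ i) (0<Y i)) (0<η (suc i)))))

  -- By `Δη`, ρ i η (i + 1) = η i (η i - η (i + 1)); hence each step multiplies η Q by x i / ρ i,
  -- while π is only divided by ρ i.
  ηQ≡π∏x : ∀ i → η i * Q i ≡ π i * ∏ x i
  ηQ≡π∏x zero    = trans (cong (_* Q 0) η₀≡δ₀) (trans π₀≡ (sym (*-identityʳ (π 0))))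
  ηQ≡π∏x (suc i) = *-cancelˡ-≡-pos (0<ρ i) (begin
    r * (f * Q (suc i))
      ≡⟨ cong (λ q → r * (f * q)) (Q-suc i) ⟩
    r * (f * (Q i * a))
      ≡⟨ trans (sym (*-identityˡ _)) (cong (_* (r * (f * (Q i * a)))) (sym (Yη i))) ⟩
    z * η i * (r * (f * (Q i * a)))
      ≡⟨ solve 6 (λ z e r f q a → z :* e :* (r :* (f :* (q :* a))) := e :* q :* (a :* (r :* z :* f)))
           refl z (η i) r f (Q i) a ⟩
    η i * Q i * (a * (r * z * f))
      ≡⟨ cong₂ (λ p q → p * (a * q)) (trans (ηQ≡π∏x i) (cong (_* ∏ x i) (π≡ i))) (sym (Δη i)) ⟩
    r * π (suc i) * ∏ x i * x i
      ≡⟨ solve 4 (λ r p b c → r :* p :* b :* c := r :* (p :* (b :* c)))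
           refl r (π (suc i)) (∏ x i) (x i) ⟩
    r * (π (suc i) * ∏ x (suc i)) ∎)
    where
    open ≡-Reasoning
    f z r a : ℚ
    f = η (suc i)
    z = Y i
    r = ρ i
    a = A i

  -- Over the denominator Q i the greedy remainder then has numerator at most π i, hence at most the
  -- actual one.
  ∏x≤1⇒η≤δ : ∀ i → ∏ x i ≤ 1ℚ → η i ≤ δ i
  ∏x≤1⇒η≤δ i ∏≤1 with δ i <? η i
  ... | no  δ≮η = ≮⇒≥ δ≮η
  ... | yes δ<η = *-cancelʳ-≤-pos (Q i) {{positive 0<Q}} (begin
    η i * Q i    ≡⟨ ηQ≡π∏x i ⟩
    π i * ∏ x i  ≤⟨ *-monoˡ-≤-nonNeg (π i) {{nonNegative (<⇒≤ (0<π i))}} ∏≤1 ⟩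
    π i * 1ℚ     ≡⟨ *-identityʳ (π i) ⟩
    π i          ≤⟨ π≤δQ i ⟩
    δ i * Q i    ∎)
    where
    open ≤-Reasoning
    0<Q : 0ℚ < Q i
    0<Q with 0ℚ <? Q i
    ... | yes p = p
    ... | no ¬p = contradiction (<-≤-trans (0<π i) (≤-trans (π≤δQ i) (≤-reflexive
        (trans (cong (δ i *_) (≤-antisym (≮⇒≥ ¬p) (0≤Q i))) (*-zeroʳ (δ i))))))
      (<-irrefl refl)

  -- Summation by parts with the nondecreasing weights A.
  invariant : ∀ n → A n * (η n - δ n) + ∑ x n ≤ fromℕ n × η n ≤ δ n
  invariant zero    = ≤-reflexive (trans (+-identityʳ _)
      (trans (cong (λ p → A 0 * (p - δ 0)) η₀≡δ₀)
      (trans (cong (A 0 *_) (+-inverseʳ (δ 0))) (*-zeroʳ (A 0)))))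
    , ≤-reflexive η₀≡δ₀
  invariant (suc n) = (begin
      A (suc n) * (η (suc n) - δ (suc n)) + ∑ x (suc n)
        -- The larger weight may replace A n because it multiplies η - δ ≤ 0.
        ≤⟨ +-monoˡ-≤ (∑ x (suc n)) (*-monoʳ-≤-nonPos (η (suc n) - δ (suc n))
             {{nonPositive η-δ≤0}} (A-mono n)) ⟩
      A n * (η (suc n) - δ (suc n)) + ∑ x (suc n)
        ≤⟨ weighted ⟩
      fromℕ (suc n) ∎)
    , η≤δ
    where
    open ≤-Reasoning
    weighted : A n * (η (suc n) - δ (suc n)) + ∑ x (suc n) ≤ fromℕ (suc n)
    weighted = begin
      A n * (η (suc n) - δ (suc n)) + (∑ x n + A n * (η n - η (suc n)))
        ≡⟨ solve 6 (λ a e f d d' s →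
             a :* (f :- d') :+ (s :+ a :* (e :- f)) := a :* (e :- d) :+ s :+ a :* (d :- d'))
             refl (A n) (η n) (η (suc n)) (δ n) (δ (suc n)) (∑ x n) ⟩
      A n * (η n - δ n) + ∑ x n + A n * (δ n - δ (suc n))
        ≡⟨ cong (A n * (η n - δ n) + ∑ x n +_) (A*Δδ n) ⟩
      A n * (η n - δ n) + ∑ x n + 1ℚ
        ≤⟨ +-monoˡ-≤ 1ℚ (proj₁ (invariant n)) ⟩
      fromℕ n + 1ℚ
        ≡⟨ fromℕ-suc n ⟨
      fromℕ (suc n) ∎
    η≤δ : η (suc n) ≤ δ (suc n)
    η≤δ with η (suc n) ≤? δ (suc n)
    ... | yes p = p
    -- If η exceeded δ, the weighted term would be nonnegative, so the x i would have mean at most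
    -- 1, and AM-GM would bound their product by 1.
    ... | no ¬p = ∏x≤1⇒η≤δ (suc n) (≤-trans (am-gm 0≤x (suc n) 0≤1
        (≤-trans ∑≤ (≤-reflexive (sym (*-identityʳ (fromℕ (suc n)))))))
        (≤-reflexive (1^ℚ (suc n))))
      where
      ∑≤ : ∑ x (suc n) ≤ fromℕ (suc n)
      ∑≤ = ≤-trans (≤-by (A n * (η (suc n) - δ (suc n)))
        (mul-nonneg (0≤A n) (<⇒≤ (0<p-q (≰⇒> ¬p))))
        (+-comm (∑ x (suc n)) (A n * (η (suc n) - δ (suc n))))) weighted
    η-δ≤0 : η (suc n) - δ (suc n) ≤ 0ℚ
    η-δ≤0 = subst (η (suc n) - δ (suc n) ≤_) (+-inverseʳ (δ (suc n)))
      (+-monoˡ-≤ (- δ (suc n)) η≤δ)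

  1≤δY : ∀ n → 1ℚ ≤ δ n * growth ρ y₀ n
  1≤δY n = begin
    1ℚ         ≡⟨ trans (*-comm (η n) (Y n)) (Yη n) ⟨
    η n * Y n  ≤⟨ *-monoʳ-≤-nonNeg (Y n) {{nonNegative (<⇒≤ (0<Y n))}} (proj₂ (invariant n)) ⟩
    δ n * Y n  ∎
    where open ≤-Reasoning

-- Sylvester sequences: reciprocals of the remainders of the greedy expansion of 1/y

sylvester : ℚ → ℕ → ℚ
sylvester = growth (λ _ → 1ℚ)

sylvester-suc : ∀ y k → sylvester y (suc k) ≡ sylvester y k * (sylvester y k + 1ℚ)
sylvester-suc y k = trans (growth-suc (λ _ → 1ℚ) y k)
  (cong (λ p → sylvester y k * (p + 1ℚ)) (*-identityʳ (sylvester y k)))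

sylvester-pos : ∀ {y} → 0ℚ < y → ∀ k → 0ℚ < sylvester y k
sylvester-pos = growth-pos (λ _ → 0<1)

sylvester-+ : ∀ y m k → sylvester y (m ℕ.+ k) ≡ sylvester (sylvester y m) k
sylvester-+ y zero    k = refl
sylvester-+ y (suc m) k = sylvester-+ (y * (y * 1ℚ + 1ℚ)) m k

sylvester-≥ : ∀ {c y} → 0ℚ ≤ c → c ≤ y → ∀ k → c ≤ sylvester y k
sylvester-≥         0≤c c≤y zero    = c≤y
sylvester-≥ {c} {y} 0≤c c≤y (suc k) = sylvester-≥ 0≤c (≤-trans c≤y
  (≤-by (y * y) (sq-nonneg (≤-trans 0≤c c≤y))
    (solve 1 (λ y → y :+ y :* y := y :* (y :* con 1ℚ :+ con 1ℚ)) refl y))) k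

2ℚ : ℚ
2ℚ = 1ℚ + 1ℚ

-- A ratio 1 + θ of the two sequences becomes at least (1 + θ)(1 + θ y/(y + 1)). As y ≥ 1 and θ ≥
-- 2κ, the second factor is at least 1 + κ, so the ratio grows at least linearly. The summand 2 in j
-- + 2 secures θ ≥ 2κ from the start.
sylvester-separates : ∀ {y t κ} → 1ℚ ≤ y → 0ℚ ≤ κ → y * (1ℚ + (fromℕ 0 + 2ℚ) * κ) ≤ t →
  ∀ j → sylvester y j * (1ℚ + (fromℕ j + 2ℚ) * κ) ≤ sylvester t j
sylvester-separates 1≤y 0≤κ base zero = base
sylvester-separates {y₀} {t₀} {κ} 1≤y₀ 0≤κ base (suc j) = begin
  sylvester y₀ (suc j) * (1ℚ + (fromℕ (suc j) + 2ℚ) * κ)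
    ≡⟨ cong₂ (λ p m → p * (1ℚ + (m + 2ℚ) * κ)) (sylvester-suc y₀ j) (fromℕ-suc j) ⟩
  y * (y + 1ℚ) * (1ℚ + (k + 1ℚ + 2ℚ) * κ)
    ≤⟨ ≤-by (y * (y * (θ * θ) + y * (k * κ) + (y - 1ℚ) * κ))
         (mul-nonneg 0≤y (add-nonneg (add-nonneg (mul-nonneg 0≤y (sq-nonneg 0≤θ))
           (mul-nonneg 0≤y (mul-nonneg 0≤k 0≤κ))) (mul-nonneg (0≤p-q 1≤y) 0≤κ)))
         (solve 3 (λ y k κ → let θ = (k :+ (con 1ℚ :+ con 1ℚ)) :* κ in
             y :* (y :+ con 1ℚ) :* (con 1ℚ :+ (k :+ con 1ℚ :+ (con 1ℚ :+ con 1ℚ)) :* κ)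
               :+ y :* (y :* (θ :* θ) :+ y :* (k :* κ) :+ (y :- con 1ℚ) :* κ)
             := y :* (con 1ℚ :+ θ) :* (y :* (con 1ℚ :+ θ) :+ con 1ℚ)) refl y k κ) ⟩
  u * (u + 1ℚ)
    ≤⟨ *-monoʳ-≤-nonNeg (u + 1ℚ) {{nonNegative (add-nonneg 0≤u 0≤1)}} u≤t ⟩
  t * (u + 1ℚ)
    ≤⟨ *-monoˡ-≤-nonNeg t {{nonNegative (≤-trans 0≤u u≤t)}} (+-monoˡ-≤ 1ℚ u≤t) ⟩
  t * (t + 1ℚ)
    ≡⟨ sylvester-suc t₀ j ⟨
  sylvester t₀ (suc j) ∎
  where
  open ≤-Reasoning
  y t k θ u : ℚ
  y = sylvester y₀ j
  t = sylvester t₀ j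
  k = fromℕ j
  θ = (k + 2ℚ) * κ
  u = y * (1ℚ + θ)
  u≤t : u ≤ t
  u≤t = sylvester-separates 1≤y₀ 0≤κ base j
  0≤k : 0ℚ ≤ k
  0≤k = 0≤fromℕ j
  1≤y : 1ℚ ≤ y
  1≤y = sylvester-≥ 0≤1 1≤y₀ j
  0≤y : 0ℚ ≤ y
  0≤y = ≤-trans 0≤1 1≤y
  0≤θ : 0ℚ ≤ θ
  0≤θ = mul-nonneg (add-nonneg 0≤k (add-nonneg 0≤1 0≤1)) 0≤κ
  0≤u : 0ℚ ≤ u
  0≤u = mul-nonneg 0≤y (add-nonneg 0≤1 0≤θ)

-- The bound π for the numerators: P up to index K and 1 afterwards. Its successive ratios are P at
-- K and 1 elsewhere.
dropAfter dropRatio : ℚ → ℕ → ℕ → ℚ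
dropAfter P K       zero    = P
dropAfter P zero    (suc k) = 1ℚ
dropAfter P (suc K) (suc k) = dropAfter P K k
dropRatio P zero    zero    = P
dropRatio P zero    (suc k) = 1ℚ
dropRatio P (suc K) zero    = 1ℚ
dropRatio P (suc K) (suc k) = dropRatio P K k

dropAfter-ratio : ∀ P K k → dropAfter P K k ≡ dropRatio P K k * dropAfter P K (suc k)
dropAfter-ratio P zero    zero    = sym (*-identityʳ P)
dropAfter-ratio P zero    (suc k) = refl
dropAfter-ratio P (suc K) zero    = sym (*-identityˡ P)
dropAfter-ratio P (suc K) (suc k) = dropAfter-ratio P K k

dropAfter-pos : ∀ {P} → 0ℚ < P → ∀ K k → 0ℚ < dropAfter P K k
dropAfter-pos 0<P K       zero    = 0<P
dropAfter-pos 0<P zero    (suc k) = 0<1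
dropAfter-pos 0<P (suc K) (suc k) = dropAfter-pos 0<P K k

dropRatio-pos : ∀ {P} → 0ℚ < P → ∀ K k → 0ℚ < dropRatio P K k
dropRatio-pos 0<P zero    zero    = 0<P
dropRatio-pos 0<P zero    (suc k) = 0<1
dropRatio-pos 0<P (suc K) zero    = 0<1
dropRatio-pos 0<P (suc K) (suc k) = dropRatio-pos 0<P K k

dropAfter-≤ : ∀ {P} {f : ℕ → ℚ} K → (∀ k → k ℕ.≤ K → P ≤ f k) → (∀ k → 1ℚ ≤ f k) →
              ∀ k → dropAfter P K k ≤ f k
dropAfter-≤ K       P≤f 1≤f zero    = P≤f 0 ℕ.z≤n
dropAfter-≤ zero    P≤f 1≤f (suc k) = 1≤f (suc k)
dropAfter-≤ (suc K) P≤f 1≤f (suc k) =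
  dropAfter-≤ K (λ i i≤K → P≤f (suc i) (ℕ.s≤s i≤K)) (λ i → 1≤f (suc i)) k

growth-dropRatio : ∀ P K y k → growth (dropRatio P K) y (suc K ℕ.+ k) ≡
                   sylvester (sylvester y K * (sylvester y K * P + 1ℚ)) k
growth-dropRatio P zero    y k = refl
growth-dropRatio P (suc K) y k = growth-dropRatio P K (y * (y * 1ℚ + 1ℚ)) k

-- Strict separation from the Sylvester sequence of `t₀`

module Separation
  (A δ Q : ℕ → ℚ) (p : ℕ → ℕ)
  (0≤A : ∀ i → 0ℚ ≤ A i) (A-mono : ∀ i → A i ≤ A (suc i))
  (A*Δδ : ∀ i → A i * (δ i - δ (suc i)) ≡ 1ℚ)
  (0<δ : ∀ i → 0ℚ < δ i)
  (Q-suc : ∀ i → Q (suc i) ≡ Q i * A i) (0≤Q : ∀ i → 0ℚ ≤ Q i)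
  (δQ≡p : ∀ i → δ i * Q i ≡ fromℕ (p i)) (1≤p : ∀ i → 1 ℕ.≤ p i)
  (t₀ : ℚ) (2≤t₀ : 2ℚ ≤ t₀) (j₀ : ℕ)
  (δ≤1 : ∀ i → j₀ ℕ.≤ i → δ i ≤ 1ℚ)
  (1<tδ : ∀ i → j₀ ℕ.≤ i → 1ℚ < sylvester t₀ i * δ i)
  where

  -- The `+ 1` pays for the denominators `sylvester z k + 1`, which stay below (z + 1)^(2^k) or
  -- equal it, whereas `sylvester t₀ (m + k)` is at least the 2^k-th power of `sylvester t₀ m`.
  Separated : Set
  Separated = ∃₂ λ m z → 0ℚ < z × z + 1ℚ < sylvester t₀ m × (∀ k → 1ℚ ≤ δ (k ℕ.+ m) * sylvester z k)

  -- As long as p stays ≥ P, the remainders are no smaller than the greedy ones started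
  -- from 1/δ m < t m, which fall behind t by any given factor, so that even a drop of p
  -- from P to 1 cannot make up for it.
  separated-from : ∀ {P} → Acc ℕ._<_ P → ∀ m → j₀ ℕ.≤ m → p m ≡ P → Separated
  -- Only k ≤ K is searched: a drop beyond K is covered by `dropAfter`.
  separated-from (acc rec) m j₀≤m refl = go (ℕ.anyUpTo? (λ k → p (k ℕ.+ m) ℕ.<? p m) (suc K))
    where
    open ≤-Reasoning
    P t y κ : ℚ
    P = fromℕ (p m)
    t = sylvester t₀ m
    y = proj₁ (reciprocal (0<δ m))
    -- Chosen so that 1 + 2κ = t δ m = t / y, the ratio of the two starting values.
    κ = (t * δ m - 1ℚ) * ½

    δy≡1 : δ m * y ≡ 1ℚ
    δy≡1 = proj₂ (proj₂ (reciprocal (0<δ m)))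

    0<y : 0ℚ < y
    0<y = proj₁ (proj₂ (reciprocal (0<δ m)))

    0<κ : 0ℚ < κ
    0<κ = mul-pos (0<p-q (1<tδ m j₀≤m)) (positive⁻¹ ½)

    1≤P : 1ℚ ≤ P
    1≤P = fromℕ-mono-≤ {1} {p m} (1≤p m)

    0<P : 0ℚ < P
    0<P = <-≤-trans 0<1 1≤P

    1≤y : 1ℚ ≤ y
    1≤y = begin
      1ℚ       ≡⟨ δy≡1 ⟨
      δ m * y  ≤⟨ *-monoʳ-≤-nonNeg y {{nonNegative (<⇒≤ 0<y)}} (δ≤1 m j₀≤m) ⟩
      1ℚ * y   ≡⟨ *-identityˡ y ⟩
      y        ∎

    base : y * (1ℚ + (fromℕ 0 + 2ℚ) * κ) ≤ t
    base = ≤-reflexive (trans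
      (solve 3 (λ y t d → y :* (con 1ℚ :+ (con 0ℚ :+ (con 1ℚ :+ con 1ℚ)) :* ((t :* d :- con 1ℚ) :* con ½))
        := t :* (d :* y)) refl y t (δ m))
      (trans (cong (t *_) δy≡1) (*-identityʳ t)))

    1/κ : ∃ λ r → 0ℚ < r × κ * r ≡ 1ℚ
    1/κ = reciprocal 0<κ

    r : ℚ
    r = proj₁ 1/κ

    K : ℕ
    -- After K steps the ratio of the two sequences is at least 2 P.
    K = proj₁ (archimedean (2ℚ * P * r))

    2P≤Kκ : 2ℚ * P ≤ fromℕ K * κ
    2P≤Kκ = begin
      2ℚ * P            ≡⟨ *-identityʳ (2ℚ * P) ⟨
      2ℚ * P * 1ℚ       ≡⟨ cong (2ℚ * P *_) (trans (*-comm r κ) (proj₂ (proj₂ 1/κ))) ⟨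
      2ℚ * P * (r * κ)  ≡⟨ *-assoc (2ℚ * P) r κ ⟨
      2ℚ * P * r * κ    ≤⟨ *-monoʳ-≤-nonNeg κ {{nonNegative (<⇒≤ 0<κ)}}
                             (proj₂ (archimedean (2ℚ * P * r))) ⟩
      fromℕ K * κ       ∎

    g h z : ℚ
    g = sylvester y K
    -- Half of the competitor: z ≤ h (h + 1), and h (h + 1) + 1 is less than 2h (2h + 1), the next
    -- competitor.
    h = sylvester t₀ (K ℕ.+ m) * ½
    z = g * (g * P + 1ℚ)

    0<g : 0ℚ < g
    0<g = sylvester-pos 0<y K

    gP≤h : g * P ≤ h
    gP≤h = begin
      g * P
        ≡⟨ solve 2 (λ g P → g :* P := g :* ((con 1ℚ :+ con 1ℚ) :* P) :* con ½) refl g P ⟩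
      g * (2ℚ * P) * ½
        ≤⟨ *-monoʳ-≤-nonNeg ½ (*-monoˡ-≤-nonNeg g {{nonNegative (<⇒≤ 0<g)}}
             (≤-trans 2P≤Kκ (≤-by (1ℚ + 2ℚ * κ)
               (add-nonneg 0≤1 (mul-nonneg (add-nonneg 0≤1 0≤1) (<⇒≤ 0<κ)))
               (solve 2 (λ k κ → k :* κ :+ (con 1ℚ :+ (con 1ℚ :+ con 1ℚ) :* κ)
                 := con 1ℚ :+ (k :+ (con 1ℚ :+ con 1ℚ)) :* κ) refl (fromℕ K) κ)))) ⟩
      g * (1ℚ + (fromℕ K + 2ℚ) * κ) * ½
        ≤⟨ *-monoʳ-≤-nonNeg ½ (sylvester-separates 1≤y (<⇒≤ 0<κ) base K) ⟩
      sylvester t K * ½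
        ≡⟨ cong (_* ½) (trans (sym (sylvester-+ t₀ m K)) (cong (sylvester t₀) (ℕ.+-comm m K))) ⟩
      h ∎

    1≤h : 1ℚ ≤ h
    1≤h = *-monoʳ-≤-nonNeg ½ (sylvester-≥ (add-nonneg 0≤1 0≤1) 2≤t₀ (K ℕ.+ m))

    g≤h : g ≤ h
    g≤h = ≤-trans (≤-trans (≤-reflexive (sym (*-identityʳ g)))
      (*-monoˡ-≤-nonNeg g {{nonNegative (<⇒≤ 0<g)}} 1≤P)) gP≤h

    z+1<t : z + 1ℚ < sylvester t₀ (suc K ℕ.+ m)
    z+1<t = begin-strict
      g * (g * P + 1ℚ) + 1ℚ
        ≤⟨ +-monoˡ-≤ 1ℚ (*-monoʳ-≤-nonNeg (g * P + 1ℚ)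
             {{nonNegative (add-nonneg (<⇒≤ (mul-pos 0<g 0<P)) 0≤1)}} g≤h) ⟩
      h * (g * P + 1ℚ) + 1ℚ
        ≤⟨ +-monoˡ-≤ 1ℚ (*-monoˡ-≤-nonNeg h {{nonNegative (≤-trans 0≤1 1≤h)}} (+-monoˡ-≤ 1ℚ gP≤h)) ⟩
      h * (h + 1ℚ) + 1ℚ
        <⟨ <-by (2ℚ * (h * (h - 1ℚ)) + (h * h - 1ℚ) + 2ℚ * h + h)
             (+-mono-≤-< (add-nonneg (add-nonneg
                 (mul-nonneg (add-nonneg 0≤1 0≤1) (mul-nonneg 0≤h (0≤p-q 1≤h)))
                 (0≤p-q (≤-trans 1≤h (≤-by (h * (h - 1ℚ)) (mul-nonneg 0≤h (0≤p-q 1≤h))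
                   (solve 1 (λ h → h :+ h :* (h :- con 1ℚ) := h :* h) refl h)))))
                 (mul-nonneg (add-nonneg 0≤1 0≤1) 0≤h))
               (<-≤-trans 0<1 1≤h))
             (solve 1 (λ T → let h = T :* con ½ ; 2: = con 1ℚ :+ con 1ℚ in
               h :* (h :+ con 1ℚ) :+ con 1ℚ
                 :+ (2: :* (h :* (h :- con 1ℚ)) :+ (h :* h :- con 1ℚ) :+ 2: :* h :+ h)
               := T :* (T :+ con 1ℚ)) refl (sylvester t₀ (K ℕ.+ m))) ⟩
      sylvester t₀ (K ℕ.+ m) * (sylvester t₀ (K ℕ.+ m) + 1ℚ)
        ≡⟨ sylvester-suc t₀ (K ℕ.+ m) ⟨
      sylvester t₀ (suc K ℕ.+ m) ∎
      where
      0≤h : 0ℚ ≤ h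
      0≤h = ≤-trans 0≤1 1≤h

    go : _ → Separated
    go (yes (k , _ , pₖ<P)) =
      separated-from (rec pₖ<P) (k ℕ.+ m) (ℕ.≤-trans j₀≤m (ℕ.m≤n+m m k)) refl
    -- No numerator up to K falls below P, so `dropAfter P K` is a valid bound, attained at m. The
    -- tail after the drop is the Sylvester sequence of z.
    go (no none) = suc K ℕ.+ m , z
      , mul-pos 0<g (+-mono-< (mul-pos 0<g 0<P) 0<1)
      , z+1<t
      , λ k → subst₂ (λ i q → 1ℚ ≤ δ i * q)
          (trans (cong (ℕ._+ m) (ℕ.+-comm (suc K) k)) (ℕ.+-assoc k (suc K) m))
          (growth-dropRatio P K y k)
          (1≤δY (suc K ℕ.+ k))
      where
      P≤p : ∀ k → k ℕ.≤ K → P ≤ fromℕ (p (k ℕ.+ m))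
      P≤p k k≤K = fromℕ-mono-≤ (ℕ.≮⇒≥ λ pₖ<P → none (k , ℕ.s≤s k≤K , pₖ<P))

      open Comparison (λ i → A (i ℕ.+ m)) (λ i → δ (i ℕ.+ m)) (λ i → Q (i ℕ.+ m))
        (dropAfter P K) (dropRatio P K)
        (λ i → 0≤A (i ℕ.+ m)) (λ i → A-mono (i ℕ.+ m)) (λ i → A*Δδ (i ℕ.+ m)) (0<δ m)
        (λ i → Q-suc (i ℕ.+ m)) (λ i → 0≤Q (i ℕ.+ m))
        (dropAfter-pos 0<P K) (dropRatio-pos 0<P K) (dropAfter-ratio P K)
        (δQ≡p m)
        (λ i → subst (dropAfter P K i ≤_) (sym (δQ≡p (i ℕ.+ m)))
          (dropAfter-≤ K P≤p (λ k → fromℕ-mono-≤ {1} {p (k ℕ.+ m)} (1≤p (k ℕ.+ m))) i))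
        y 0<y δy≡1

  separated : Separated
  separated = separated-from (<-wellFounded (p j₀)) j₀ ℕ.≤-refl refl

-- Recurrence of denominators not exceeding the greedy ones

module Dips
  (A δ : ℕ → ℚ)
  (A*Δδ : ∀ i → A i * (δ i - δ (suc i)) ≡ 1ℚ)
  (δ-mono : ∀ i → δ (suc i) < δ i)
  (δ→0 : ∀ ε → 0ℚ < ε → ∃ λ M → ∀ n → M ℕ.≤ n → δ n < ε)
  (z : ℚ) (0<z : 0ℚ < z) (1≤δG : ∀ k → 1ℚ ≤ δ k * sylvester z k)
  where

  G η : ℕ → ℚ
  G = sylvester z
  η k = proj₁ (reciprocal (sylvester-pos 0<z k))

  0<G : ∀ k → 0ℚ < G k
  0<G = sylvester-pos 0<z

  0<η : ∀ k → 0ℚ < η k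
  0<η k = proj₁ (proj₂ (reciprocal (sylvester-pos 0<z k)))

  Gη : ∀ k → G k * η k ≡ 1ℚ
  Gη k = proj₂ (proj₂ (reciprocal (sylvester-pos 0<z k)))

  [G+1]*Δη : ∀ k → (G k + 1ℚ) * (η k - η (suc k)) ≡ 1ℚ
  [G+1]*Δη k = begin
    (g + 1ℚ) * (e - f)
      ≡⟨ cong₂ (λ p q → (g + 1ℚ) * (p - q)) (sym (*-identityʳ e)) (sym (*-identityʳ f)) ⟩
    (g + 1ℚ) * (e * 1ℚ - f * 1ℚ)
      ≡⟨ cong₂ (λ p q → (g + 1ℚ) * (e * p - f * q)) (sym G'f) (sym (Gη k)) ⟩
    (g + 1ℚ) * (e * (g * (g + 1ℚ) * f) - f * (g * e))
      ≡⟨ solve 3 (λ g e f → (g :+ con 1ℚ) :* (e :* (g :* (g :+ con 1ℚ) :* f) :- f :* (g :* e))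
           := g :* e :* (g :* (g :+ con 1ℚ) :* f)) refl g e f ⟩
    g * e * (g * (g + 1ℚ) * f)
      ≡⟨ cong₂ _*_ (Gη k) G'f ⟩
    1ℚ ∎
    where
    open ≡-Reasoning
    g e f : ℚ
    g = G k
    e = η k
    f = η (suc k)
    G'f : g * (g + 1ℚ) * f ≡ 1ℚ
    G'f = trans (cong (_* f) (sym (sylvester-suc z k))) (Gη (suc k))

  Δδ<Δη : ∀ k → G k + 1ℚ < A k → δ k - δ (suc k) < η k - η (suc k)
  Δδ<Δη k G+1<A = *-cancelˡ-<-nonNeg (G k + 1ℚ) {{nonNegative (add-nonneg (<⇒≤ (0<G k)) 0≤1)}}
    (begin-strict
      (G k + 1ℚ) * (δ k - δ (suc k))
        <⟨ *-monoˡ-<-pos (δ k - δ (suc k)) {{positive (0<p-q (δ-mono k))}} G+1<A ⟩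
      A k * (δ k - δ (suc k))
        ≡⟨ trans (A*Δδ k) (sym ([G+1]*Δη k)) ⟩
      (G k + 1ℚ) * (η k - η (suc k)) ∎)
    where open ≤-Reasoning

  -- A denominator above the greedy one takes less from δ than the greedy step takes from η.
  gap-grows : ∀ k → G k + 1ℚ < A k → δ k - η k < δ (suc k) - η (suc k)
  gap-grows k G+1<A = <-by (η k - η (suc k) - (δ k - δ (suc k))) (0<p-q (Δδ<Δη k G+1<A))
    (solve 4 (λ d d' e f → d :- e :+ (e :- f :- (d :- d')) := d' :- f) refl
      (δ k) (δ (suc k)) (η k) (η (suc k)))

  η≤δ : ∀ k → η k ≤ δ k
  η≤δ k = *-cancelʳ-≤-pos (G k) {{positive (0<G k)}}
    (subst (_≤ δ k * G k) (sym (trans (*-comm (η k) (G k)) (Gη k))) (1≤δG k))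

  Dip : ℕ → Set
  Dip N = ∃ λ k → N ℕ.≤ k × A k ≤ G k + 1ℚ

  -- While no dip occurs, the gap δ - η stays at least g; but δ bounds the gap and is below g after
  -- f steps, so the search succeeds.
  dip-within : ∀ f k {g} → g ≤ δ k - η k → δ (f ℕ.+ k) < g → Dip k
  dip-within zero k {g} g≤ δ<g = contradiction (<-≤-trans δ<g (≤-trans g≤
    (≤-by (η k) (<⇒≤ (0<η k)) (solve 2 (λ d e → d :- e :+ e := d) refl (δ k) (η k)))))
    (<-irrefl refl)
  dip-within (suc f) k {g} g≤ δ<g with A k ≤? G k + 1ℚ
  ... | yes dip = k , ℕ.≤-refl , dip
  ... | no ¬dip = let k' , k<k' , dip = dip-within f (suc k)
                        (≤-trans g≤ (<⇒≤ (gap-grows k (≰⇒> ¬dip))))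
                        (subst (λ i → δ i < g) (sym (ℕ.+-suc f k)) δ<g)
                  in k' , ℕ.<⇒≤ k<k' , dip

  dip-after : ∀ N → Dip N
  dip-after N with A N ≤? G N + 1ℚ
  ... | yes dip = N , ℕ.≤-refl , dip
  -- One step without a dip turns η ≤ δ into a positive gap, which serves as g.
  ... | no ¬dip = let M , δ<g = δ→0 (δ (suc N) - η (suc N)) 0<gap
                      k , N<k , dip = dip-within M (suc N) ≤-refl
                        (δ<g (M ℕ.+ suc N) (ℕ.m≤m+n M (suc N)))
                  in k , ℕ.<⇒≤ N<k , dip
    where
    0<gap : 0ℚ < δ (suc N) - η (suc N)
    0<gap = ≤-<-trans (0≤p-q (η≤δ N)) (gap-grows N (≰⇒> ¬dip))

-- Powers p^(2ⁿ)

^2^-suc : ∀ n p → p ^2^ suc n ≡ (p ^2^ n) * (p ^2^ n)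
^2^-suc zero    p = refl
^2^-suc (suc n) p = ^2^-suc n (p * p)

^2^-+ : ∀ m n p → p ^2^ (m ℕ.+ n) ≡ (p ^2^ m) ^2^ n
^2^-+ zero    n p = refl
^2^-+ (suc m) n p = ^2^-+ m n (p * p)

-- c is the first multiple of h whose square exceeds u.
square-in-grid : ∀ {u v h B} → 0ℚ ≤ u → 0ℚ < h → h ≤ 1ℚ → 0ℚ ≤ B → u < B * B →
                 u + (2ℚ * B + 1ℚ) * h < v →
                 ∀ j → u < fromℕ j * h * (fromℕ j * h) → ∃ λ c → 0ℚ < c × u < c * c × c * c < v
square-in-grid {u} {h = h} 0≤u _ _ _ _ _ zero u< = contradiction (≤-<-trans 0≤u (subst (u <_)
  (solve 1 (λ h → con 0ℚ :* h :* (con 0ℚ :* h) := con 0ℚ) refl h) u<)) (<-irrefl refl)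
square-in-grid {u} {v} {h} {B} 0≤u 0<h h≤1 0≤B u<BB small (suc j) u<
  with u <? fromℕ j * h * (fromℕ j * h)
... | yes u<xx = square-in-grid 0≤u 0<h h≤1 0≤B u<BB small j u<xx
... | no  u≮xx = fromℕ (suc j) * h
  , mul-pos (fromℕ-mono-< {0} {suc j} (ℕ.s≤s ℕ.z≤n)) 0<h , u< , (begin-strict
    fromℕ (suc j) * h * (fromℕ (suc j) * h)
      ≡⟨ trans (cong (λ m → m * h * (m * h)) (fromℕ-suc j))
           (solve 2 (λ k h → let x = k :* h in (k :+ con 1ℚ) :* h :* ((k :+ con 1ℚ) :* h)
             := x :* x :+ ((con 1ℚ :+ con 1ℚ) :* x :+ h) :* h) refl (fromℕ j) h) ⟩
    x * x + (2ℚ * x + h) * h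
      ≤⟨ +-mono-≤ (≮⇒≥ u≮xx) (*-monoʳ-≤-nonNeg h {{nonNegative (<⇒≤ 0<h)}}
           (+-mono-≤ (*-monoˡ-≤-nonNeg 2ℚ (x≤B (x ≤? B))) h≤1)) ⟩
    u + (2ℚ * B + 1ℚ) * h
      <⟨ small ⟩
    v ∎)
  where
  open ≤-Reasoning
  x : ℚ
  x = fromℕ j * h
  x≤B : Dec (x ≤ B) → x ≤ B
  x≤B (yes x≤B) = x≤B
  x≤B (no  x≰B) = contradiction (<-trans u<BB (sq-mono 0≤B (≰⇒> x≰B))) u≮xx

-- On a fine enough grid, successive squares near u differ by less than v - u.
square-dense : ∀ {u v} → 0ℚ ≤ u → u < v → ∃ λ c → 0ℚ < c × u < c * c × c * c < v
square-dense {u} {v} 0≤u u<v = square-in-grid 0≤u 0<h h≤1 0≤B u<BB small top (<-≤-trans u<BB (≤-trans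
    (*-monoˡ-≤-nonNeg B {{nonNegative 0≤B}} B≤top*h)
    (*-monoʳ-≤-nonNeg (fromℕ top * h) {{nonNegative (≤-trans 0≤B B≤top*h)}} B≤top*h)))
  where
  open ≤-Reasoning
  B D : ℚ
  -- The summand 1 makes B² exceed u even when v is small.
  B = v + 1ℚ
  -- With h D = v - u, the increment (2B + 1) h falls short of v - u by exactly h.
  D = 2ℚ * B + 2ℚ

  0<v : 0ℚ < v
  0<v = ≤-<-trans 0≤u u<v

  1≤B : 1ℚ ≤ B
  1≤B = +-monoˡ-≤ 1ℚ (<⇒≤ 0<v)

  0≤B : 0ℚ ≤ B
  0≤B = ≤-trans 0≤1 1≤B

  0<D : 0ℚ < D
  0<D = +-mono-≤-< (mul-nonneg (add-nonneg 0≤1 0≤1) 0≤B) (+-mono-< 0<1 0<1)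

  1/D : ∃ λ r → 0ℚ < r × D * r ≡ 1ℚ
  1/D = reciprocal 0<D

  h : ℚ
  h = (v - u) * proj₁ 1/D

  0<h : 0ℚ < h
  0<h = mul-pos (0<p-q u<v) (proj₁ (proj₂ 1/D))

  hD≡v-u : h * D ≡ v - u
  hD≡v-u = trans (solve 3 (λ w r D → w :* r :* D := w :* (D :* r)) refl (v - u) (proj₁ 1/D) D)
    (trans (cong ((v - u) *_) (proj₂ (proj₂ 1/D))) (*-identityʳ (v - u)))

  h≤1 : h ≤ 1ℚ
  h≤1 = *-cancelʳ-≤-pos D {{positive 0<D}} (≤-by (u + v + 2ℚ + 2ℚ)
    (add-nonneg (add-nonneg (add-nonneg 0≤u (<⇒≤ 0<v)) (add-nonneg 0≤1 0≤1)) (add-nonneg 0≤1 0≤1))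
    (trans (cong (_+ (u + v + 2ℚ + 2ℚ)) hD≡v-u)
      (solve 2 (λ u v → let 2: = con 1ℚ :+ con 1ℚ in
        v :- u :+ (u :+ v :+ 2: :+ 2:) := con 1ℚ :* (2: :* (v :+ con 1ℚ) :+ 2:)) refl u v)))

  u<BB : u < B * B
  u<BB = <-trans u<v (<-by (v * v + v + 1ℚ)
    (+-mono-≤-< (add-nonneg (sq-nonneg (<⇒≤ 0<v)) (<⇒≤ 0<v)) 0<1)
    (solve 1 (λ v → v :+ (v :* v :+ v :+ con 1ℚ) := (v :+ con 1ℚ) :* (v :+ con 1ℚ)) refl v))

  small : u + (2ℚ * B + 1ℚ) * h < v
  small = <-by h 0<h (trans
    (solve 3 (λ u B h → let 2: = con 1ℚ :+ con 1ℚ in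
      u :+ (2: :* B :+ con 1ℚ) :* h :+ h := u :+ h :* (2: :* B :+ 2:)) refl u B h)
    (trans (cong (λ p → u + p) hD≡v-u) (solve 2 (λ u v → u :+ (v :- u) := v) refl u v)))

  1/h : ∃ λ r → 0ℚ < r × h * r ≡ 1ℚ
  1/h = reciprocal 0<h

  top : ℕ
  top = proj₁ (archimedean (B * proj₁ 1/h))

  B≤top*h : B ≤ fromℕ top * h
  B≤top*h = begin
    B                        ≡⟨ *-identityʳ B ⟨
    B * 1ℚ                   ≡⟨ cong (B *_) (proj₂ (proj₂ 1/h)) ⟨
    B * (h * proj₁ 1/h)      ≡⟨ solve 3 (λ B h r → B :* (h :* r) := B :* r :* h) refl B h (proj₁ 1/h) ⟩
    B * proj₁ 1/h * h        ≤⟨ *-monoʳ-≤-nonNeg h {{nonNegative (<⇒≤ 0<h)}}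
                                  (proj₂ (archimedean (B * proj₁ 1/h))) ⟩
    fromℕ top * h              ∎

-- By induction there is e with its power between u and v; `pow-up` opens an interval above e, in
-- which a square is then found.
^2^-dense : ∀ n {u v} → 0ℚ ≤ u → u < v → ∃ λ c → 0ℚ < c × u < c ^2^ n × c ^2^ n < v
^2^-dense zero 0≤u u<v =
  let c , u<c , c<v = <-dense u<v in c , ≤-<-trans 0≤u u<c , u<c , c<v
^2^-dense (suc n) 0≤u u<v =
  let e , 0<e , u<eⁿ , eⁿ<v = ^2^-dense n 0≤u u<v
      f , e<f , fⁿ<v        = pow-up n (<⇒≤ 0<e) eⁿ<v
      c , 0<c , e<cc , cc<f = square-dense (<⇒≤ 0<e) e<f
  in c , 0<c , <-trans u<eⁿ (pow-mono n (<⇒≤ 0<e) e<cc)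
           , <-trans (pow-mono n (sq-nonneg (<⇒≤ 0<c)) cc<f) fⁿ<v

^2^-nonneg : ∀ n {p} → 0ℚ ≤ p → 0ℚ ≤ p ^2^ n
^2^-nonneg zero    0≤p = 0≤p
^2^-nonneg (suc n) 0≤p = ^2^-nonneg n (sq-nonneg 0≤p)

-- Since g (g + 1) + 1 ≤ (g + 1)², the shifted sequence at most squares at each step.
sylvester+1≤^2^ : ∀ {z} → 0ℚ < z → ∀ k → sylvester z k + 1ℚ ≤ (z + 1ℚ) ^2^ k
sylvester+1≤^2^ 0<z zero = ≤-refl
sylvester+1≤^2^ {z} 0<z (suc k) = begin
  sylvester z (suc k) + 1ℚ
    ≤⟨ ≤-by g 0≤g (trans (cong (λ p → p + 1ℚ + g) (sylvester-suc z k))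
         (solve 1 (λ g → g :* (g :+ con 1ℚ) :+ con 1ℚ :+ g := (g :+ con 1ℚ) :* (g :+ con 1ℚ)) refl g)) ⟩
  (g + 1ℚ) * (g + 1ℚ)
    ≤⟨ *-monoˡ-≤-nonNeg (g + 1ℚ) {{nonNegative 0≤g+1}} ih ⟩
  (g + 1ℚ) * w
    ≤⟨ *-monoʳ-≤-nonNeg w {{nonNegative (≤-trans 0≤g+1 ih)}} ih ⟩
  w * w
    ≡⟨ ^2^-suc k (z + 1ℚ) ⟨
  (z + 1ℚ) ^2^ suc k ∎
  where
  open ≤-Reasoning
  g w : ℚ
  g = sylvester z k
  w = (z + 1ℚ) ^2^ k
  ih : g + 1ℚ ≤ w
  ih = sylvester+1≤^2^ 0<z k
  0≤g : 0ℚ ≤ g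
  0≤g = <⇒≤ (sylvester-pos 0<z k)
  0≤g+1 : 0ℚ ≤ g + 1ℚ
  0≤g+1 = add-nonneg 0≤g 0≤1

-- Since g (g + 1) ≥ g², the sequence itself at least squares at each step.
^2^≤sylvester : ∀ {t} → 0ℚ < t → ∀ k → t ^2^ k ≤ sylvester t k
^2^≤sylvester 0<t zero = ≤-refl
^2^≤sylvester {t} 0<t (suc k) = begin
  t ^2^ suc k    ≡⟨ ^2^-suc k t ⟩
  w * w          ≤⟨ *-monoˡ-≤-nonNeg w {{nonNegative (^2^-nonneg k (<⇒≤ 0<t))}} ih ⟩
  w * g          ≤⟨ *-monoʳ-≤-nonNeg g {{nonNegative (<⇒≤ 0<g)}} w≤g+1 ⟩
  (g + 1ℚ) * g   ≡⟨ *-comm (g + 1ℚ) g ⟩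
  g * (g + 1ℚ)   ≡⟨ sylvester-suc t k ⟨
  sylvester t (suc k) ∎
  where
  open ≤-Reasoning
  g w : ℚ
  g = sylvester t k
  w = t ^2^ k
  ih : w ≤ g
  ih = ^2^≤sylvester 0<t k
  0<g : 0ℚ < g
  0<g = sylvester-pos 0<t k
  w≤g+1 : w ≤ g + 1ℚ
  w≤g+1 = ≤-trans ih (≤-by 1ℚ 0≤1 refl)

-- Sums of unit fractions

recip-anti-< : ∀ {m n} → 1 ℕ.≤ m → m ℕ.< n → recip n < recip m
recip-anti-< {m} {n} 1≤m m<n =
  *-cancelˡ-<-nonNeg (fromℕ m * fromℕ n) {{nonNegative (mul-nonneg (0≤fromℕ m) (0≤fromℕ n))}}
    (subst₂ _<_ (sym eqₙ) (sym eqₘ) (fromℕ-mono-< m<n))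
  where
  eqₙ : fromℕ m * fromℕ n * recip n ≡ fromℕ m
  eqₙ = trans (*-assoc (fromℕ m) (fromℕ n) (recip n))
    (trans (cong (fromℕ m *_) (fromℕ*recip {n} (ℕ.≤-trans 1≤m (ℕ.<⇒≤ m<n)))) (*-identityʳ (fromℕ m)))
  eqₘ : fromℕ m * fromℕ n * recip m ≡ fromℕ n
  eqₘ = trans (solve 3 (λ m n r → m :* n :* r := m :* r :* n) refl (fromℕ m) (fromℕ n) (recip m))
    (trans (cong (_* fromℕ n) (fromℕ*recip {m} 1≤m)) (*-identityˡ (fromℕ n)))

-- The greedy step: it turns T into T (T + 1), as in the recursion for `T`.
recip-split : ∀ {n} → 1 ℕ.≤ n → recip n ≡ recip (suc n) + recip (n ℕ.* suc n)
recip-split {n} 1≤n = *-cancelˡ-≡-pos (mul-pos 0<x 0<x') (begin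
  x * x' * recip n
    ≡⟨ solve 3 (λ x x' r → x :* x' :* r := x :* r :* x') refl x x' (recip n) ⟩
  x * recip n * x'
    ≡⟨ trans (cong (_* x') (fromℕ*recip {n} 1≤n)) (*-identityˡ x') ⟩
  x'
    ≡⟨ fromℕ-suc n ⟩
  x + 1ℚ
    ≡⟨ cong₂ _+_ (trans (cong (x *_) (fromℕ*recip {suc n} 1≤suc)) (*-identityʳ x)) one ⟨
  x * (x' * recip (suc n)) + x * x' * recip (n ℕ.* suc n)
    ≡⟨ solve 4 (λ x x' r s → x :* (x' :* r) :+ x :* x' :* s := x :* x' :* (r :+ s))
         refl x x' (recip (suc n)) (recip (n ℕ.* suc n)) ⟩
  x * x' * (recip (suc n) + recip (n ℕ.* suc n)) ∎)
  where
  open ≡-Reasoning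
  x x' : ℚ
  x  = fromℕ n
  x' = fromℕ (suc n)
  1≤suc : 1 ℕ.≤ suc n
  1≤suc = ℕ.s≤s ℕ.z≤n
  0<x : 0ℚ < x
  0<x = fromℕ-mono-< {0} {n} 1≤n
  0<x' : 0ℚ < x'
  0<x' = fromℕ-mono-< {0} {suc n} 1≤suc
  one : x * x' * recip (n ℕ.* suc n) ≡ 1ℚ
  one = trans (cong (_* recip (n ℕ.* suc n)) (sym (fromℕ-* n (suc n))))
    (fromℕ*recip {n ℕ.* suc n} (ℕ.*-mono-≤ 1≤n 1≤suc))

Σrecip-snoc : ∀ a n → Σrecip (prefix a (suc n)) ≡ Σrecip (prefix a n) + recip (a n)
Σrecip-snoc a zero    = +-comm (recip (a 0)) 0ℚ
Σrecip-snoc a (suc n) = trans (cong (recip (a 0) +_) (Σrecip-snoc (a ∘ suc) n))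
  (sym (+-assoc (recip (a 0)) (Σrecip (prefix (a ∘ suc) n)) (recip (a (suc n)))))

prefix-injective : ∀ {a b} n → prefix a n ≡ prefix b n → ∀ i → i ℕ.< n → a i ≡ b i
prefix-injective         (suc n) eq zero    _           = Vec.∷-injectiveˡ eq
prefix-injective {a} {b} (suc n) eq (suc i) (ℕ.s≤s i<n) =
  prefix-injective {a ∘ suc} {b ∘ suc} n (Vec.∷-injectiveʳ eq) i i<n

linked-prefix : ∀ {a x} n → (0 ℕ.< n → x ℕ.≤ a 0) →
                (∀ i → suc i ℕ.< n → a i ℕ.≤ a (suc i)) → Linked ℕ._≤_ (x ∷ prefix a n)
linked-prefix zero    x≤a₀ mono = [-]
linked-prefix {a} (suc n) x≤a₀ mono = x≤a₀ (ℕ.s≤s ℕ.z≤n) ∷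
  linked-prefix {a ∘ suc} n (λ 0<n → mono 0 (ℕ.s≤s 0<n)) (λ i i<n → mono (suc i) (ℕ.s≤s i<n))

linked-head : ∀ {a x} n → Linked ℕ._≤_ (x ∷ prefix a n) → 0 ℕ.< n → x ℕ.≤ a 0
linked-head (suc n) (x≤a₀ ∷ _) _ = x≤a₀

linked-mono : ∀ {a x} n → Linked ℕ._≤_ (x ∷ prefix a n) → ∀ i → suc i ℕ.< n → a i ℕ.≤ a (suc i)
linked-mono {a} (suc n) (_ ∷ l) zero    (ℕ.s≤s 0<n) = linked-head {a ∘ suc} n l 0<n
linked-mono {a} (suc n) (_ ∷ l) (suc i) (ℕ.s≤s i<n) = linked-mono {a ∘ suc} n l i i<n

-- Serves to place T₀ + 1 in a prefix of b without breaking its order.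
insert : ∀ {n} → ℕ → Vec ℕ n → Vec ℕ (suc n)
insert x []       = x ∷ []
insert x (y ∷ ys) with x ℕ.≤? y
... | yes _ = x ∷ y ∷ ys
... | no  _ = y ∷ insert x ys

insert-linked : ∀ {n w x} (ys : Vec ℕ n) → w ℕ.≤ x → Linked ℕ._≤_ (w ∷ ys) →
                Linked ℕ._≤_ (w ∷ insert x ys)
insert-linked []       w≤x _ = w≤x ∷ [-]
insert-linked {x = x} (y ∷ ys) w≤x (w≤y ∷ l) with x ℕ.≤? y
... | yes x≤y = w≤x ∷ x≤y ∷ l
... | no  x≰y = w≤y ∷ insert-linked ys (ℕ.<⇒≤ (ℕ.≰⇒> x≰y)) l

Σrecip-insert : ∀ {n} x (ys : Vec ℕ n) → Σrecip (insert x ys) ≡ recip x + Σrecip ys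
Σrecip-insert x []       = refl
Σrecip-insert x (y ∷ ys) with x ℕ.≤? y
... | yes _ = refl
... | no  _ = trans (cong (recip y +_) (Σrecip-insert x ys))
  (solve 3 (λ p q s → q :+ (p :+ s) := p :+ (q :+ s)) refl (recip x) (recip y) (Σrecip ys))

deficit : ℚ → (ℕ → ℕ) → ℕ → ℚ
deficit lam a n = lam - Σrecip (prefix a n)

deficit-suc : ∀ lam a n → deficit lam a n - deficit lam a (suc n) ≡ recip (a n)
deficit-suc lam a n = trans
  (cong (λ s → lam - Σrecip (prefix a n) - (lam - s)) (Σrecip-snoc a n))
  (solve 3 (λ l s r → l :- s :- (l :- (s :+ r)) := r) refl lam (Σrecip (prefix a n)) (recip (a n)))

p≤∣p∣ : ∀ p → p ≤ ∣ p ∣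
p≤∣p∣ p with ∣p∣≡p∨∣p∣≡-p p
... | inj₁ eq = ≤-reflexive (sym eq)
... | inj₂ eq with ≤-total 0ℚ p
...   | inj₁ 0≤p = ≤-reflexive (sym (0≤p⇒∣p∣≡p 0≤p))
...   | inj₂ p≤0 = ≤-trans p≤0 (0≤∣p∣ p)

-- Remainders of a nondecreasing series of unit fractions

module Series
  (lam : ℚ) (a : ℕ → ℕ) (2≤a₀ : 2 ℕ.≤ a 0) (a-mono : ∀ i → a i ℕ.≤ a (suc i))
  (sums : SeriesSumsTo a lam)
  where

  2≤a : ∀ i → 2 ℕ.≤ a i
  2≤a zero    = 2≤a₀
  2≤a (suc i) = ℕ.≤-trans (2≤a i) (a-mono i)

  1≤a : ∀ i → 1 ℕ.≤ a i
  1≤a i = ℕ.<⇒≤ (2≤a i)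

  𝓔-prefix : ∀ n → 𝓔 (prefix a n)
  𝓔-prefix n = linked-prefix n (λ _ → 2≤a₀) (λ i _ → a-mono i)

  R : ℕ → ℚ
  R = deficit lam a

  R-decreasing : ∀ n → R (suc n) < R n
  R-decreasing n = <-by (recip (a n)) (recip-pos (1≤a n))
    (trans (cong (λ r → R (suc n) + r) (sym (deficit-suc lam a n)))
      (solve 2 (λ r r' → r' :+ (r :- r') := r) refl (R n) (R (suc n))))

  R-anti : ∀ k n → R (k ℕ.+ n) ≤ R n
  R-anti zero    n = ≤-refl
  R-anti (suc k) n = ≤-trans (<⇒≤ (R-decreasing (k ℕ.+ n))) (R-anti k n)

  R→0 : ∀ ε → 0ℚ < ε → ∃ λ M → ∀ n → M ℕ.≤ n → R n < ε
  R→0 ε 0<ε = let M , close = sums ε 0<ε in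
    M , λ n M≤n → ≤-<-trans (≤-trans (p≤∣p∣ (R n)) (≤-reflexive (∣R∣≡ n))) (close n M≤n)
    where
    ∣R∣≡ : ∀ n → ∣ R n ∣ ≡ ∣ Σrecip (prefix a n) - lam ∣
    ∣R∣≡ n = trans (sym (∣-p∣≡∣p∣ (R n))) (cong ∣_∣
      (solve 2 (λ l s → :- (l :- s) := s :- l) refl lam (Σrecip (prefix a n))))

  -- If R n were at most 0, all later partial sums would exceed lam by at least 1 / a n, against
  -- convergence.
  0<R : ∀ n → 0ℚ < R n
  0<R n with 0ℚ <? R n
  ... | yes 0<Rn = 0<Rn
  ... | no  0≮Rn = contradiction (close (M ℕ.+ suc n) (ℕ.m≤m+n M (suc n))) (≤⇒≯ (begin
    recip (a n)
      ≤⟨ ≤-by (0ℚ - R n + (R (suc n) - R (M ℕ.+ suc n)))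
           (add-nonneg (0≤p-q (≮⇒≥ 0≮Rn)) (0≤p-q (R-anti M (suc n))))
           (trans (cong (_+ (0ℚ - R n + (R (suc n) - R (M ℕ.+ suc n)))) (sym (deficit-suc lam a n)))
             (solve 4 (λ r r' l s → r :- r' :+ (con 0ℚ :- r :+ (r' :- (l :- s))) := s :- l) refl
               (R n) (R (suc n)) lam (Σrecip (prefix a (M ℕ.+ suc n))))) ⟩
    Σrecip (prefix a (M ℕ.+ suc n)) - lam
      ≤⟨ p≤∣p∣ _ ⟩
    ∣ Σrecip (prefix a (M ℕ.+ suc n)) - lam ∣ ∎))
    where
    open ≤-Reasoning
    M : ℕ
    M = proj₁ (sums (recip (a n)) (recip-pos (1≤a n)))
    close : ∀ k → M ℕ.≤ k → ∣ Σrecip (prefix a k) - lam ∣ < recip (a n)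
    close = proj₂ (sums (recip (a n)) (recip-pos (1≤a n)))
    ≤⇒≯ : ∀ {p q} → p ≤ q → ¬ q < p
    ≤⇒≯ p≤q q<p = <-irrefl refl (≤-<-trans p≤q q<p)

  underapproximation : ∀ n → Underapproximation lam n (Σrecip (prefix a n))
  underapproximation n = prefix a n , 𝓔-prefix n , refl ,
    <-by (R n) (0<R n) (solve 2 (λ l s → s :+ (l :- s) := l) refl lam (Σrecip (prefix a n)))

  a*ΔR : ∀ n → fromℕ (a n) * (R n - R (suc n)) ≡ 1ℚ
  a*ΔR n = trans (cong (fromℕ (a n) *_) (deficit-suc lam a n)) (fromℕ*recip (1≤a n))

  -- Fractions are not reduced, so that Q gains exactly the factor a n, as `Comparison` demands.
  Q : ℕ → ℕ
  Q zero    = ↧ₙ lam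
  Q (suc n) = Q n ℕ.* a n

  numerator : ℕ → ℤ
  numerator zero    = ↥ lam
  numerator (suc n) = numerator n ℤ.* ℤ.+ a n ℤ.- ℤ.+ Q n

  RQ≡numerator : ∀ n → R n * fromℕ (Q n) ≡ fromℤ (numerator n)
  RQ≡numerator zero    = trans (cong (_* fromℕ (↧ₙ lam))
    (solve 1 (λ l → l :- con 0ℚ := l) refl lam)) (denominator-integral lam)
  RQ≡numerator (suc n) = begin
    R (suc n) * fromℕ (Q n ℕ.* a n)
      ≡⟨ cong (R (suc n) *_) (fromℕ-* (Q n) (a n)) ⟩
    R (suc n) * (q * α)
      ≡⟨ solve 4 (λ r r' q α → r' :* (q :* α) := r :* q :* α :- q :* (α :* (r :- r')))
           refl (R n) (R (suc n)) q α ⟩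
    R n * q * α - q * (α * (R n - R (suc n)))
      ≡⟨ cong₂ (λ p p' → p * α - p') (RQ≡numerator n)
           (trans (cong (q *_) (a*ΔR n)) (*-identityʳ q)) ⟩
    fromℤ (numerator n) * α - q
      ≡⟨ cong₂ _+_ (fromℤ-* (numerator n) (ℤ.+ a n)) (fromℤ-neg (ℤ.+ Q n)) ⟨
    fromℤ (numerator n ℤ.* ℤ.+ a n) + fromℤ (ℤ.- ℤ.+ Q n)
      ≡⟨ fromℤ-+ (numerator n ℤ.* ℤ.+ a n) (ℤ.- ℤ.+ Q n) ⟨
    fromℤ (numerator (suc n)) ∎
    where
    open ≡-Reasoning
    q α : ℚ
    q = fromℕ (Q n)
    α = fromℕ (a n)

  1≤Q : ∀ n → 1 ℕ.≤ Q n
  1≤Q zero    = ℕ.s≤s ℕ.z≤n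
  1≤Q (suc n) = ℕ.*-mono-≤ (1≤Q n) (1≤a n)

  -- The integer numerators are positive because R and Q are; they carry the well-founded induction
  -- of `Separation`.
  RQ-integral : ∀ n → ∃ λ p → 1 ℕ.≤ p × R n * fromℕ (Q n) ≡ fromℕ p
  RQ-integral n = natural (numerator n) (RQ≡numerator n)
    where
    0<RQ : 0ℚ < R n * fromℕ (Q n)
    0<RQ = mul-pos (0<R n) (fromℕ-mono-< {0} {Q n} (1≤Q n))
    natural : ∀ i → R n * fromℕ (Q n) ≡ fromℤ i → ∃ λ p → 1 ℕ.≤ p × R n * fromℕ (Q n) ≡ fromℕ p
    natural (ℤ.+ suc p)    eq = suc p , ℕ.s≤s ℕ.z≤n , eq
    natural (ℤ.+ zero)     eq = contradiction (subst (0ℚ <_) eq 0<RQ) (<-irrefl refl)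
    natural ℤ.-[1+ p ]   eq = contradiction (<-trans (subst (0ℚ <_) eq 0<RQ)
      (negative⁻¹ (fromℤ ℤ.-[1+ p ]) {{ neg-pos {fromℕ (suc p)} (normalize-pos (suc p) 1) }})) (<-irrefl refl)

-- The eventually greedy best sequence

module GreedyBest (lam : ℚ) (b : ℕ → ℕ) (best-b : EventuallyGreedyBest lam b) where
  open EventuallyGreedyBest best-b

  1≤T : ∀ j → 1 ℕ.≤ T T₀ j
  1≤T zero    = ℕ.<⇒≤ 2≤T₀
  1≤T (suc j) = ℕ.*-mono-≤ (1≤T j) (ℕ.s≤s ℕ.z≤n)

  sylvester≡T : ∀ j → sylvester (fromℕ T₀) j ≡ fromℕ (T T₀ j)
  sylvester≡T zero    = refl
  sylvester≡T (suc j) = begin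
    sylvester (fromℕ T₀) (suc j)
      ≡⟨ sylvester-suc (fromℕ T₀) j ⟩
    sylvester (fromℕ T₀) j * (sylvester (fromℕ T₀) j + 1ℚ)
      ≡⟨ cong (λ t → t * (t + 1ℚ)) (sylvester≡T j) ⟩
    fromℕ (T T₀ j) * (fromℕ (T T₀ j) + 1ℚ)
      ≡⟨ cong (fromℕ (T T₀ j) *_) (fromℕ-suc (T T₀ j)) ⟨
    fromℕ (T T₀ j) * fromℕ (suc (T T₀ j))
      ≡⟨ fromℕ-* (T T₀ j) (suc (T T₀ j)) ⟨
    fromℕ (T T₀ (suc j)) ∎
    where open ≡-Reasoning

  -- By induction: the term 1/(T j + 1) is split off from 1/T j.
  deficit≡recip-T : ∀ j → deficit lam b (N ℕ.+ j) ≡ recip (T T₀ j)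
  deficit≡recip-T zero = trans (cong (deficit lam b) (ℕ.+-identityʳ N))
    (trans (cong (_- Σrecip (prefix b N)) remainder)
      (solve 2 (λ s r → s :+ r :- s := r) refl (Σrecip (prefix b N)) (recip T₀)))
  deficit≡recip-T (suc j) = begin
    R (N ℕ.+ suc j)
      ≡⟨ cong R (ℕ.+-suc N j) ⟩
    R (suc (N ℕ.+ j))
      ≡⟨ solve 2 (λ r r' → r' := r :- (r :- r')) refl (R (N ℕ.+ j)) (R (suc (N ℕ.+ j))) ⟩
    R (N ℕ.+ j) - (R (N ℕ.+ j) - R (suc (N ℕ.+ j)))
      ≡⟨ cong₂ _-_ (trans (deficit≡recip-T j) (recip-split (1≤T j)))
           (trans (deficit-suc lam b (N ℕ.+ j)) (cong recip (greedy j))) ⟩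
    recip (suc (T T₀ j)) + recip (T T₀ (suc j)) - recip (suc (T T₀ j))
      ≡⟨ solve 2 (λ r s → r :+ s :- r := s) refl (recip (suc (T T₀ j))) (recip (T T₀ (suc j))) ⟩
    recip (T T₀ (suc j)) ∎
    where
    open ≡-Reasoning
    R : ℕ → ℚ
    R = deficit lam b

  b-N : b N ≡ suc T₀
  b-N = trans (cong b (sym (ℕ.+-identityʳ N))) (greedy 0)

  2≤b₀ : 2 ℕ.≤ b 0
  2≤b₀ = linked-head {b} N (proj₁ maximizing) 1≤N

  b-mono-below : ∀ i → suc i ℕ.< N → b i ℕ.≤ b (suc i)
  b-mono-below = linked-mono {b} N (proj₁ maximizing)

  -- Otherwise replacing the last term b n by T₀ + 1 would improve on the maximum.
  last≤sucT₀ : ∀ n → suc n ≡ N → b n ℕ.≤ suc T₀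
  last≤sucT₀ n sucn≡N with b n ℕ.≤? suc T₀
  ... | yes b≤ = b≤
  ... | no  b≰ = contradiction (<-≤-trans improved (proj₂ isR (Σrecip v) (v , v∈𝓔 , refl , v<lam)))
      (<-irrefl refl)
    where
    open ≤-Reasoning
    S : ℚ
    S = Σrecip (prefix b n)
    v : Vec ℕ (suc n)
    v = insert (suc T₀) (prefix b n)
    isR : IsR lam (suc n) (Σrecip (prefix b (suc n)))
    isR = subst (λ m → IsR lam m (Σrecip (prefix b m))) (sym sucn≡N) (proj₂ maximizing)
    v∈𝓔 : 𝓔 v
    v∈𝓔 = insert-linked (prefix b n) (ℕ.m≤n⇒m≤1+n 2≤T₀)
      (linked-prefix {b} n (λ _ → 2≤b₀)
        (λ i i<n → b-mono-below i (subst (suc i ℕ.<_) sucn≡N (ℕ.m≤n⇒m≤1+n i<n))))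
    b>sucT₀ : suc T₀ ℕ.< b n
    b>sucT₀ = ℕ.≰⇒> b≰
    -- Here lam = S + 1/b n + 1/T₀, and 1/(T₀ + 1) is less than 1/T₀.
    v<lam : Σrecip v < lam
    v<lam = begin-strict
      Σrecip v
        ≡⟨ Σrecip-insert (suc T₀) (prefix b n) ⟩
      recip (suc T₀) + S
        <⟨ +-monoˡ-< S (recip-anti-< {T₀} (ℕ.<⇒≤ 2≤T₀) (ℕ.n<1+n T₀)) ⟩
      recip T₀ + S
        ≤⟨ ≤-by (recip (b n)) (<⇒≤ (recip-pos (ℕ.≤-trans (ℕ.s≤s ℕ.z≤n) (ℕ.<⇒≤ b>sucT₀))))
             (solve 3 (λ t s r → t :+ s :+ r := s :+ r :+ t) refl (recip T₀) S (recip (b n))) ⟩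
      S + recip (b n) + recip T₀
        ≡⟨ cong (_+ recip T₀) (Σrecip-snoc b n) ⟨
      Σrecip (prefix b (suc n)) + recip T₀
        ≡⟨ trans (cong (λ m → Σrecip (prefix b m) + recip T₀) sucn≡N) (sym remainder) ⟩
      lam ∎
    improved : Σrecip (prefix b (suc n)) < Σrecip v
    improved = begin-strict
      Σrecip (prefix b (suc n))  ≡⟨ Σrecip-snoc b n ⟩
      S + recip (b n)            <⟨ +-monoʳ-< S (recip-anti-< {suc T₀} (ℕ.s≤s ℕ.z≤n) b>sucT₀) ⟩
      S + recip (suc T₀)         ≡⟨ +-comm S (recip (suc T₀)) ⟩
      recip (suc T₀) + S         ≡⟨ Σrecip-insert (suc T₀) (prefix b n) ⟨
      Σrecip v                   ∎

  -- Before N this is membership in `𝓔`, at the junction maximality, beyond it the growth of `T`. It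
  -- puts every prefix of b into `𝓔`, where uniqueness applies.
  b-mono : ∀ i → b i ℕ.≤ b (suc i)
  b-mono i with ℕ.<-cmp (suc i) N
  ... | tri< i<N _ _ = b-mono-below i i<N
  ... | tri≈ _ i≡N _ = subst (b i ℕ.≤_) (sym (trans (cong b i≡N) b-N)) (last≤sucT₀ i i≡N)
  ... | tri> _ _ (ℕ.s≤s N≤i) = subst₂ ℕ._≤_
      (sym (trans (cong b i≡) (greedy j)))
      (sym (trans (cong b (trans (cong suc i≡) (sym (ℕ.+-suc N j)))) (greedy (suc j))))
      (ℕ.s≤s (ℕ.m≤m*n (T T₀ j) (suc (T T₀ j))))
    where
    j : ℕ
    j = i ℕ.∸ N
    i≡ : i ≡ N ℕ.+ j
    i≡ = sym (ℕ.m+[n∸m]≡n N≤i)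

-- Application to a series that differs from `b`

module Corollary
  (lam : ℚ) (unique : ∀ n → 1 ℕ.≤ n → ∃! _≡_ (IsMaximizing lam {n}))
  (b : ℕ → ℕ) (best-b : EventuallyGreedyBest lam b)
  (a : ℕ → ℕ) (2≤a₀ : 2 ℕ.≤ a 0) (a-mono : ∀ i → a i ℕ.≤ a (suc i)) (a-sums : SeriesSumsTo a lam)
  (i₀ : ℕ) (a≢b : a i₀ ≢ b i₀)
  where
  open EventuallyGreedyBest best-b
  open GreedyBest lam b best-b
  open Series lam a 2≤a₀ a-mono a-sums
  module B = Series lam b 2≤b₀ b-mono sums

  -- Were the sum over a not smaller, both prefixes would be maximizing, and uniqueness would make
  -- them agree at i₀.
  sum-below : ∀ n → N ℕ.≤ n → i₀ ℕ.< n → Σrecip (prefix a n) < Σrecip (prefix b n)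
  sum-below n N≤n i₀<n with Σrecip (prefix a n) <? Σrecip (prefix b n)
  ... | yes a<b = a<b
  ... | no  a≮b = contradiction (prefix-injective {a} {b} n prefix≡ i₀ i₀<n) a≢b
    where
    Σ≡ : Σrecip (prefix b n) ≡ Σrecip (prefix a n)
    Σ≡ = ≤-antisym (≮⇒≥ a≮b) (proj₂ (best n N≤n) _ (underapproximation n))
    unique-max : ∃! _≡_ (IsMaximizing lam {n})
    unique-max = unique n (ℕ.≤-trans 1≤N N≤n)
    prefix≡ : prefix a n ≡ prefix b n
    prefix≡ = trans
      (sym (proj₂ (proj₂ unique-max) (𝓔-prefix n , subst (IsR lam n) Σ≡ (best n N≤n))))
      (proj₂ (proj₂ unique-max) (B.𝓔-prefix n , best n N≤n))

  t₀ : ℚ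
  t₀ = fromℕ T₀

  -- The shift by N aligns δ j with the remainder 1/T j of b.
  δ : ℕ → ℚ
  δ j = R (j ℕ.+ N)

  -- From j₀ on, the prefixes contain the index i₀ and the remainders are below 1.
  M₁ j₀ : ℕ
  M₁ = proj₁ (R→0 1ℚ 0<1)
  j₀ = suc i₀ ℕ.+ M₁

  δ≤1 : ∀ j → j₀ ℕ.≤ j → δ j ≤ 1ℚ
  δ≤1 j j₀≤j = <⇒≤ (proj₂ (R→0 1ℚ 0<1) (j ℕ.+ N)
    (ℕ.≤-trans (ℕ.m≤n+m M₁ (suc i₀)) (ℕ.≤-trans j₀≤j (ℕ.m≤m+n j N))))

  -- By `sum-below`, the remainder of a exceeds that of b, which is 1/T j.
  1<tδ : ∀ j → j₀ ℕ.≤ j → 1ℚ < sylvester t₀ j * δ j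
  1<tδ j j₀≤j = begin-strict
    1ℚ
      ≡⟨ fromℕ*recip (1≤T j) ⟨
    fromℕ (T T₀ j) * recip (T T₀ j)
      <⟨ *-monoʳ-<-pos (fromℕ (T T₀ j)) {{positive (fromℕ-mono-< {0} {T T₀ j} (1≤T j))}} recip<δ ⟩
    fromℕ (T T₀ j) * δ j
      ≡⟨ cong (_* δ j) (sylvester≡T j) ⟨
    sylvester t₀ j * δ j ∎
    where
    open ≤-Reasoning
    recip<δ : recip (T T₀ j) < δ j
    recip<δ = subst (_< δ j)
      (trans (cong (deficit lam b) (ℕ.+-comm j N)) (deficit≡recip-T j))
      (+-monoʳ-< lam (neg-antimono-< (sum-below (j ℕ.+ N) (ℕ.m≤n+m N j)
        (ℕ.≤-trans (ℕ.m≤m+n (suc i₀) M₁) (ℕ.≤-trans j₀≤j (ℕ.m≤m+n j N))))))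

  open Separation (λ j → fromℕ (a (j ℕ.+ N))) δ (λ j → fromℕ (Q (j ℕ.+ N)))
    (λ j → proj₁ (RQ-integral (j ℕ.+ N)))
    (λ j → 0≤fromℕ (a (j ℕ.+ N)))
    (λ j → fromℕ-mono-≤ {a (j ℕ.+ N)} {a (suc j ℕ.+ N)} (a-mono (j ℕ.+ N)))
    (λ j → a*ΔR (j ℕ.+ N)) (λ j → 0<R (j ℕ.+ N))
    (λ j → fromℕ-* (Q (j ℕ.+ N)) (a (j ℕ.+ N))) (λ j → 0≤fromℕ (Q (j ℕ.+ N)))
    (λ j → proj₂ (proj₂ (RQ-integral (j ℕ.+ N)))) (λ j → proj₁ (proj₂ (RQ-integral (j ℕ.+ N))))
    t₀ (fromℕ-mono-≤ {2} {T₀} 2≤T₀) j₀ δ≤1 1<tδ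

  module Conclusion
    (m : ℕ) (z : ℚ) (0<z : 0ℚ < z) (1≤δG : ∀ k → 1ℚ ≤ δ (k ℕ.+ m) * sylvester z k)
    where

    -- Index k + m + N of a carries the exponent 2^(e + k), as roots are counted from 1.
    e : ℕ
    e = suc (m ℕ.+ N)

    δ→0 : ∀ ε → 0ℚ < ε → ∃ λ M → ∀ k → M ℕ.≤ k → δ (k ℕ.+ m) < ε
    δ→0 ε 0<ε = let M , R<ε = R→0 ε 0<ε in M , λ k M≤k → R<ε (k ℕ.+ m ℕ.+ N)
      (ℕ.≤-trans M≤k (ℕ.≤-trans (ℕ.m≤m+n k m) (ℕ.m≤m+n (k ℕ.+ m) N)))

    open Dips (λ k → fromℕ (a (k ℕ.+ m ℕ.+ N))) (λ k → δ (k ℕ.+ m))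
      (λ k → a*ΔR (k ℕ.+ m ℕ.+ N)) (λ k → R-decreasing (k ℕ.+ m ℕ.+ N))
      δ→0 z 0<z 1≤δG

    -- An upper bound for the outer `sup` requires one c below d that serves all tails; in each tail
    -- a dip brings a root below c.
    liminf-upper : ∀ {c d} → 0ℚ < c → c < d → z + 1ℚ < c ^2^ e → Cut.U (liminf (roots a)) d
    liminf-upper {c} 0<c c<d z+1<cᵉ = c , c<d , λ M → from-dip M (dip-after M)
      where
      open ≤-Reasoning
      from-dip : ∀ M → Dip M → Cut.U (inf λ n → cut (roots a (M ℕ.+ n))) c
      from-dip M (k , M≤k , a≤G+1) = i ℕ.∸ M ,
        subst (λ j → Cut.U (cut (roots a j)) c) (sym (ℕ.m+[n∸m]≡n M≤i)) (0<c , (begin-strict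
          fromℕ (a i)           ≤⟨ a≤G+1 ⟩
          sylvester z k + 1ℚ    ≤⟨ sylvester+1≤^2^ 0<z k ⟩
          (z + 1ℚ) ^2^ k        <⟨ pow-mono k (add-nonneg (<⇒≤ 0<z) 0≤1) z+1<cᵉ ⟩
          (c ^2^ e) ^2^ k       ≡⟨ ^2^-+ e k c ⟨
          c ^2^ (e ℕ.+ k)       ≡⟨ cong (c ^2^_) e+k≡suci ⟩
          c ^2^ suc i           ∎))
        where
        i : ℕ
        i = k ℕ.+ m ℕ.+ N
        M≤i : M ℕ.≤ i
        M≤i = ℕ.≤-trans M≤k (ℕ.≤-trans (ℕ.m≤m+n k m) (ℕ.m≤m+n (k ℕ.+ m) N))
        e+k≡suci : e ℕ.+ k ≡ suc i
        e+k≡suci = cong suc (trans (ℕ.+-comm (m ℕ.+ N) k) (sym (ℕ.+-assoc k m N)))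

    -- Locatedness decides between d and d'. If ℓ were below d', so would be the late roots of b,
    -- but `^2^≤sylvester` keeps them above d'.
    ℓ-lower : (ℓ : ℝ) → roots b ⟶ ℓ → ∀ {d d'} → 0ℚ ≤ d → d < d' →
              d' ^2^ e < sylvester t₀ m → Cut.L (cut ℓ) d
    ℓ-lower ℓ (_ , eventually-below) {d} {d'} 0≤d d<d' d'ᵉ<t with ℝ.located ℓ d<d'
    ... | inj₁ d<ℓ = d<ℓ
    ... | inj₂ ℓ<d' = contradiction (proj₂ (proj₂ (eventually-below d' ℓ<d') n M≤n))
        (<-asym d'<b)
      where
      open ≤-Reasoning
      M n : ℕ
      M = proj₁ (eventually-below d' ℓ<d')
      n = N ℕ.+ (m ℕ.+ M)
      M≤n : M ℕ.≤ n
      M≤n = ℕ.≤-trans (ℕ.m≤n+m M m) (ℕ.m≤n+m (m ℕ.+ M) N)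
      t : ℚ
      t = sylvester t₀ m
      0≤d'ᵉ : 0ℚ ≤ d' ^2^ e
      0≤d'ᵉ = ^2^-nonneg e (≤-trans 0≤d (<⇒≤ d<d'))
      sucn≡e+M : suc n ≡ e ℕ.+ M
      sucn≡e+M = cong suc (trans (sym (ℕ.+-assoc N m M)) (cong (ℕ._+ M) (ℕ.+-comm N m)))
      d'<b : d' ^2^ suc n < fromℕ (b n)
      d'<b = begin-strict
        d' ^2^ suc n                   ≡⟨ cong (d' ^2^_) sucn≡e+M ⟩
        d' ^2^ (e ℕ.+ M)               ≡⟨ ^2^-+ e M d' ⟩
        (d' ^2^ e) ^2^ M               <⟨ pow-mono M 0≤d'ᵉ d'ᵉ<t ⟩
        t ^2^ M                        ≤⟨ ^2^≤sylvester (≤-<-trans 0≤d'ᵉ d'ᵉ<t) M ⟩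
        sylvester t M                  ≡⟨ sylvester-+ t₀ m M ⟨
        sylvester t₀ (m ℕ.+ M)         ≡⟨ sylvester≡T (m ℕ.+ M) ⟩
        fromℕ (T T₀ (m ℕ.+ M))         <⟨ fromℕ-mono-< {T T₀ (m ℕ.+ M)} (ℕ.n<1+n _) ⟩
        fromℕ (suc (T T₀ (m ℕ.+ M)))   ≡⟨ cong fromℕ (greedy (m ℕ.+ M)) ⟨
        fromℕ (b n)                    ∎

  liminf<lim : (ℓ : ℝ) → roots b ⟶ ℓ → liminf (roots a) <ᶜ cut ℓ
  liminf<lim ℓ b⟶ℓ =
    let m , z , 0<z , z+1<t , 1≤δG = separated
        open Conclusion m z 0<z 1≤δG
        -- d separates the two cuts; c below it gives the room asked for by `sup`, and d' above it
        -- the room for `located`.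
        c , 0<c , z+1<cᵉ , cᵉ<t = ^2^-dense e (<⇒≤ (+-mono-< 0<z 0<1)) z+1<t
        d , c<d , dᵉ<t = pow-up e (<⇒≤ 0<c) cᵉ<t
        0≤d = <⇒≤ (<-trans 0<c c<d)
        d' , d<d' , d'ᵉ<t = pow-up e 0≤d dᵉ<t
    in d , liminf-upper 0<c c<d z+1<cᵉ , ℓ-lower ℓ b⟶ℓ 0≤d d<d' d'ᵉ<t

corollary3 : (lam : ℚ) → 0ℚ < lam →
    (∀ n → 1 ℕ.≤ n → ∃! _≡_ (IsMaximizing lam {n})) →
    (b : ℕ → ℕ) → EventuallyGreedyBest lam b →
    (a : ℕ → ℕ) → 2 ℕ.≤ a 0 → (∀ i → a i ℕ.≤ a (suc i)) → SeriesSumsTo a lam →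
    ∃ (λ i → a i ≢ b i) →
    (ℓ : ℝ) → roots b ⟶ ℓ →
    liminf (roots a) <ᶜ cut ℓ
corollary3 lam _ unique b best-b a 2≤a₀ a-mono a-sums (i , aᵢ≢bᵢ) =
  Corollary.liminf<lim lam unique b best-b a 2≤a₀ a-mono a-sums i aᵢ≢bᵢ
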